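{- Let $S$ be a commutative semiring and $\Sigma$ an alphabet. A weighted language $s:\Sigma^*\to S$ is recognized by a WAFA over $S$ and $\Sigma$ if and only if there exist a rank $r\in\mathbb N$, $r\ge 1$, a ranked alphabet $\Lambda$, a linear tree homomorphism $h:T_\Lambda\to T_{\Sigma^r_\#}$, a regular tree language $L\subseteq T_\Lambda$, and a WFTA $\mathcal A_w$ over $S$ and $\Lambda$ with exactly one state such that for all $w\in\Sigma^*$ $$s(w)=h\big([\![\mathcal A_w]\!]\odot\mathbb 1_L\big)(t^r_w).$$
   Context: An alphabet is a finite non-empty set; $\Sigma^*$ is the set of finite words over $\Sigma$, $\varepsilon$ the empty word. A semiring $(S,+,\cdot,0,1)$ has $(S,+,0)$ a commutative monoid, $(S,\cdot,1)$ a monoid, $0$ absorbing, and both distributive laws; it is commutative if $\cdot$ is commutative. For $Q=\{q_1,\dots,q_n\}$, $S[Q]$ is the semiring of polynomials with coefficients in $S$ in commuting indeterminates $q_1,\dots,q_n$, and $p\langle s_1,\dots,s_n\rangle$ denotes simultaneous substitution. WAFA. A weighted alternating finite automaton over $S$ and $\Sigma$ is $\mathcal A=(Q,\Sigma,\delta,P_0,\tau)$ with $Q=\{q_1,\dots,q_n\}$ a finite set of states, $\delta:Q\times\Sigma\to S[Q]$, $P_0\in S[Q]$, $\tau:Q\to S$. State behavior: $[\mathcal A]_q(\varepsilon)=\tau(q)$, $[\mathcal A]_q(av)=\delta(q,a)\langle[\mathcal A]_{q_1}(v),\dots,[\mathcal A]_{q_n}(v)\rangle$. Behavior: $[\![\mathcal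 A]\!](w)=P_0\langle[\mathcal A]_{q_1}(w),\dots,[\mathcal A]_{q_n}(w)\rangle$. $\mathcal A$ recognizes $s$ if $[\![\mathcal A]\!]=s$. Trees. A ranked alphabet is an alphabet $\Gamma$ with a map $\mathrm{Rank}:\Gamma\to\mathbb N$; $\Gamma^{(k)}$ is the set of symbols of rank $k$, $\mathrm{Rank}(\Gamma)$ the maximal rank. $T_\Gamma[X_n]$ is the set of $\Gamma$-terms/trees over variables $x_1,\dots,x_n$, and $T_\Gamma$ the set of those without variables; $t\langle t_1,\dots,t_n\rangle$ is simultaneous substitution. A tree homomorphism $h:T_\Lambda\to T_\Gamma$ is a map such that for each $g\in\Lambda^{(k)}$ there is $h(g)\in T_\Gamma[X_k]$ with $h(g(t_1,\dots,t_k))=h(g)\langle h(t_1),\dots,h(t_k)\rangle$ for all $t_1,\dots,t_k\in T_\Lambda$. It is linear if for each $k$ and $g\in\Lambda^{(k)}$, $h(g)$ contains at least one symbol from $\Gamma$ and each of $x_1,\dots,x_k$ occurs exactly once in $h(g)$. A regular tree language is one recognized by a (classical, unweighted) finite tree automaton. For $r\ge1$, $\Sigma^r_\#=\Sigma\cup\{\#\}$ is the ranked alphabet in which $\#\notin\Sigma$ has rank $0$ and every $a\in\Sigma$ has rank $r$. For $w\in\Sigma^*$, $t^r_w\in T_{\Sigma^r_\#}$ is defined by $t^r_\varepsilon=\#$ and $t^r_{av}=a(t^r_v,\dots,t^r_v)$ ($r$ copies). WFTA. A weighted finite tree automaton over $S$ and a ranked alphabet $\Gamma$ is $(Q,\Gamma,\delta,\lambda)$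 with $Q$ a finite set of states, $\delta=(\delta_k)_{0\le k\le\mathrm{Rank}(\Gamma)}$, $\delta_k:\Gamma^{(k)}\to S^{Q^k\times Q}$ (write $\delta_g=\delta_k(g)$), $\lambda:Q\to S$. State behavior: $[\mathcal A]_q(g(t_1,\dots,t_k))=\sum_{(p_1,\dots,p_k)\in Q^k}\delta_g((p_1,\dots,p_k),q)\prod_{i=1}^k[\mathcal A]_{p_i}(t_i)$. Behavior: $[\![\mathcal A]\!](t)=\sum_{q\in Q}\lambda(q)[\mathcal A]_q(t)$ for $t\in T_\Gamma$. $\mathbb 1_L:T_\Lambda\to S$ is the characteristic function of $L$ (value $1$ on $L$, $0$ elsewhere); $\odot$ is the pointwise product. For a linear tree homomorphism $h:T_\Lambda\to T_\Gamma$ and $u:T_\Lambda\to S$, $h(u):T_\Gamma\to S$ is defined by $h(u)(t)=\sum_{t'\in h^{ -1}(t)}u(t')$ (a finite sum). -}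

module Defs where

open import Algebra.Bundles using (CommutativeSemiring)
import Algebra.Definitions.RawSemiring as RawSemiringDefs
open import Data.Bool.Base using (Bool; T; if_then_else_)
open import Data.Bool.Properties using (T?)
open import Data.Fin.Base using (Fin; zero; suc)
import Data.Fin.Properties as Fin
open import Data.List.Base as List
  using (List; []; _∷_; allFin; cartesianProductWith; concatMap; deduplicate; filter; foldr)
open import Data.List.Membership.Propositional using (_∈_; lose)
open import Data.List.Membership.Propositional.Properties
  using (∈-allFin; ∈-cartesianProductWith⁺; ∈-concatMap⁺; ∈-deduplicate⁺; ∈-deduplicate⁻;
         ∈-filter⁺; ∈-filter⁻; ∈-map⁺)
open import Data.List.Relation.Unary.Any using (here)
open import Data.List.Relation.Unary.Unique.Propositional using (Unique)
import Data.List.Relation.Unary.Unique.DecPropositional.Properties as DecUnique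
open import Data.Maybe.Base using (Maybe; just; nothing)
open import Data.Nat.Base using (ℕ; zero; suc; _+_; _≤_; _<_; _⊔_; z≤n; s≤s)
import Data.Nat.Properties as ℕ
open import Data.Product.Base using (Σ-syntax; ∃-syntax; _×_; _,_; proj₂)
open import Data.Vec.Base as Vec using (Vec; []; _∷_; lookup; replicate)
open import Data.Vec.Relation.Binary.Pointwise.Inductive using (Pointwise; []; _∷_)
open import Function.Base using (_∘_)
open import Function.Bundles using (_↔_; _⇔_; mk⇔; mk↔ₛ′; Inverse; Equivalence)
open import Function.Properties.Inverse using (↔⇒↣)
open import Level using (0ℓ)
open import Relation.Binary.Definitions using (DecidableEquality)
open import Relation.Binary.PropositionalEquality
  using (_≡_; refl; sym; cong; cong₂; subst)
open import Relation.Nullary using (Dec; yes; no; does)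
open import Relation.Nullary.Decidable using (map′; _×-dec_; via-injection)
open import Relation.Unary using (Pred; Decidable)

record Alphabet : Set₁ where
  field
    Symbol : Set
    size-1 : ℕ
    finite : Symbol ↔ Fin (suc size-1)

  _≟_ : DecidableEquality Symbol
  _≟_ = via-injection (↔⇒↣ finite) Fin._≟_

  allSymbols : List Symbol
  allSymbols = List.map (Inverse.from finite) (allFin (suc size-1))

  ∈-allSymbols : ∀ a → a ∈ allSymbols
  ∈-allSymbols a = subst (_∈ allSymbols) (Inverse.strictlyInverseʳ finite a)
    (∈-map⁺ (Inverse.from finite) (∈-allFin (Inverse.to finite a)))

Word : Alphabet → Set
Word A = List (Alphabet.Symbol A)

record RankedAlphabet : Set₁ where
  field
    alphabet : Alphabet
    rank     : Alphabet.Symbol alphabet → ℕ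

  open Alphabet alphabet public

open RankedAlphabet using (Symbol; rank; allSymbols; ∈-allSymbols)

-- `Term Γ n` is T_Γ[Xₙ]; the variable xᵢ is `var i`, with indices starting at 0.
data Term (Γ : RankedAlphabet) (n : ℕ) : Set where
  var  : Fin n → Term Γ n
  node : (g : Symbol Γ) → Vec (Term Γ n) (rank Γ g) → Term Γ n

Tree : RankedAlphabet → Set
Tree Γ = Term Γ 0

module _ {Γ : RankedAlphabet} where

  infix 8 _[_] _[_]*

  mutual
    _[_] : ∀ {k n} → Term Γ k → Vec (Term Γ n) k → Term Γ n
    var i     [ us ] = lookup us i
    node g ts [ us ] = node g (ts [ us ]*)

    _[_]* : ∀ {k n m} → Vec (Term Γ k) m → Vec (Term Γ n) k → Vec (Term Γ n) m
    []       [ us ]* = []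
    (t ∷ ts) [ us ]* = t [ us ] ∷ ts [ us ]*

  mutual
    occurrences : ∀ {n} → Fin n → Term Γ n → ℕ
    occurrences i (var j)     = if does (i Fin.≟ j) then 1 else 0
    occurrences i (node _ ts) = occurrences* i ts

    occurrences* : ∀ {n m} → Fin n → Vec (Term Γ n) m → ℕ
    occurrences* i []       = 0
    occurrences* i (t ∷ ts) = occurrences i t + occurrences* i ts

  mutual
    symbolCount : ∀ {n} → Term Γ n → ℕ
    symbolCount (var _)     = 0
    symbolCount (node _ ts) = suc (symbolCount* ts)

    symbolCount* : ∀ {n m} → Vec (Term Γ n) m → ℕ
    symbolCount* []       = 0
    symbolCount* (t ∷ ts) = symbolCount t + symbolCount* ts

  mutual
    height : ∀ {n} → Term Γ n → ℕ
    height (var _)     = 0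
    height (node _ ts) = suc (height* ts)

    height* : ∀ {n m} → Vec (Term Γ n) m → ℕ
    height* []       = 0
    height* (t ∷ ts) = height t ⊔ height* ts

record TreeHom (Λ Γ : RankedAlphabet) : Set where
  field
    map      : Tree Λ → Tree Γ
    image    : (g : Symbol Λ) → Term Γ (rank Λ g)
    map-node : ∀ g ts → map (node g ts) ≡ image g [ Vec.map map ts ]

open TreeHom using (map; image; map-node)

Linear : ∀ {Λ Γ} → TreeHom Λ Γ → Set
Linear {Λ} h = (g : Symbol Λ) →
  (1 ≤ symbolCount (image h g)) ×
  ((i : Fin (rank Λ g)) → occurrences i (image h g) ≡ 1)

tuples : ∀ {a} {A : Set a} → List A → (k : ℕ) → List (Vec A k)
tuples xs zero    = [] ∷ []
tuples xs (suc k) = cartesianProductWith _∷_ xs (tuples xs k)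

record TreeAutomaton (Γ : RankedAlphabet) : Set where
  field
    states     : ℕ
    transition : (g : Symbol Γ) → Vec (Fin states) (rank Γ g) → Fin states → Bool
    final      : Fin states → Bool

  data Run : Tree Γ → Fin states → Set where
    run : ∀ {g ts ps q} → Pointwise Run ts ps → T (transition g ps q) → Run (node g ts) q

  Accepts : Tree Γ → Set
  Accepts t = ∃[ q ] Run t q × T (final q)

  mutual
    run? : ∀ t q → Dec (Run t q)
    run? (node g ts) q =
      map′ (λ (_ , rs , δ) → run rs δ) (λ { (run rs δ) → _ , rs , δ })
        (runs? ts (λ ps → T (transition g ps q)) (λ ps → T? (transition g ps q)))

    runs? : ∀ {k} (ts : Vec (Tree Γ) k) (P : Pred (Vec (Fin states) k) 0ℓ) → Decidable P →
            Dec (∃[ ps ] Pointwise Run ts ps × P ps)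
    runs? []       P P? =
      map′ (λ p → [] , [] , p) (λ { ([] , [] , p) → p }) (P? [])
    runs? (t ∷ ts) P P? =
      map′ (λ (p , r , ps , rs , x) → p ∷ ps , r ∷ rs , x)
           (λ { (p ∷ ps , r ∷ rs , x) → p , r , ps , rs , x })
           (Fin.any? (λ p → run? t p ×-dec runs? ts (P ∘ (p ∷_)) (P? ∘ (p ∷_))))

  accepts? : Decidable Accepts
  accepts? t = Fin.any? (λ q → run? t q ×-dec T? (final q))

Regular : ∀ {Γ} → Pred (Tree Γ) 0ℓ → Set
Regular {Γ} L = Σ[ A ∈ TreeAutomaton Γ ] (∀ t → L t ⇔ TreeAutomaton.Accepts A t)

regular? : ∀ {Γ} {L : Pred (Tree Γ) 0ℓ} → Regular L → Decidable L
regular? (A , L⇔A) t =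
  map′ (Equivalence.from (L⇔A t)) (Equivalence.to (L⇔A t)) (TreeAutomaton.accepts? A t)

-- The added symbol # is `nothing`.
_⁺# : Alphabet → Alphabet
A ⁺# = record
  { Symbol = Maybe (Alphabet.Symbol A)
  ; size-1 = suc (Alphabet.size-1 A)
  ; finite = mk↔ₛ′ to from to∘from from∘to
  }
  where
  module F = Inverse (Alphabet.finite A)

  to : Maybe (Alphabet.Symbol A) → Fin (suc (suc (Alphabet.size-1 A)))
  to nothing  = zero
  to (just a) = suc (F.to a)

  from : Fin (suc (suc (Alphabet.size-1 A))) → Maybe (Alphabet.Symbol A)
  from zero    = nothing
  from (suc i) = just (F.from i)

  to∘from : ∀ i → to (from i) ≡ i
  to∘from zero    = refl
  to∘from (suc i) = cong suc (F.strictlyInverseˡ i)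

  from∘to : ∀ a → from (to a) ≡ a
  from∘to nothing  = refl
  from∘to (just a) = cong just (F.strictlyInverseʳ a)

Ranked# : Alphabet → ℕ → RankedAlphabet
Ranked# A r = record { alphabet = A ⁺# ; rank = λ { nothing → 0 ; (just _) → r } }

wordTree : ∀ A (r : ℕ) → Word A → Tree (Ranked# A r)
wordTree A r []      = node nothing []
wordTree A r (a ∷ v) = node (just a) (replicate r (wordTree A r v))

-- The preimages of a tree under a linear homomorphism are finite in number because such a
-- homomorphism does not decrease height, and there are finitely many trees of bounded height.

module _ {Γ : RankedAlphabet} where

  mutual
    _≟ᵗ_ : ∀ {n} → DecidableEquality (Term Γ n)
    var i     ≟ᵗ var j     = map′ (cong var) (λ { refl → refl }) (i Fin.≟ j)
    var _     ≟ᵗ node _ _  = no λ ()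
    node _ _  ≟ᵗ var _     = no λ ()
    node f ts ≟ᵗ node g us with RankedAlphabet._≟_ Γ f g
    ... | no f≢g   = no λ { refl → f≢g refl }
    ... | yes refl = map′ (cong (node f)) (λ { refl → refl }) (ts ≟* us)

    _≟*_ : ∀ {n m} → DecidableEquality (Vec (Term Γ n) m)
    []       ≟* []       = yes refl
    (t ∷ ts) ≟* (u ∷ us) =
      map′ (λ (p , q) → cong₂ _∷_ p q) (λ { refl → refl , refl }) ((t ≟ᵗ u) ×-dec (ts ≟* us))

  treesUpTo : ℕ → List (Tree Γ)
  treesUpTo zero    = []
  treesUpTo (suc b) =
    concatMap (λ g → List.map (node g) (tuples (treesUpTo b) (rank Γ g))) (allSymbols Γ)

  mutual
    ∈-treesUpTo : ∀ b t → height t ≤ b → t ∈ treesUpTo b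
    ∈-treesUpTo (suc b) (node g ts) (s≤s ts≤b) =
      ∈-concatMap⁺ (λ f → List.map (node f) (tuples (treesUpTo b) (rank Γ f)))
        (lose (∈-allSymbols Γ g) (∈-map⁺ (node g) (∈-tuples b ts ts≤b)))

    ∈-tuples : ∀ {m} b (ts : Vec (Tree Γ) m) → height* ts ≤ b → ts ∈ tuples (treesUpTo b) m
    ∈-tuples b []       _    = here refl
    ∈-tuples b (t ∷ ts) ts≤b = ∈-cartesianProductWith⁺ _∷_
      (∈-treesUpTo b t (ℕ.m⊔n≤o⇒m≤o (height t) (height* ts) ts≤b))
      (∈-tuples b ts (ℕ.m⊔n≤o⇒n≤o (height t) (height* ts) ts≤b))

  height*-lub : ∀ {n m} (ts : Vec (Term Γ n) m) b → (∀ i → height (lookup ts i) ≤ b) →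
                height* ts ≤ b
  height*-lub []       b _    = z≤n
  height*-lub (t ∷ ts) b ts≤b = ℕ.⊔-lub (ts≤b zero) (height*-lub ts b (ts≤b ∘ suc))

  mutual
    height-[] : ∀ {k n} (t : Term Γ k) (us : Vec (Term Γ n) k) i → 1 ≤ occurrences i t →
                height (lookup us i) ≤ height (t [ us ])
    height-[] (var j)     us i i∈t with i Fin.≟ j
    ... | yes refl = ℕ.≤-refl
    height-[] (var j)     us i ()  | no _
    height-[] (node g ts) us i i∈t = ℕ.m≤n⇒m≤1+n (height-[]* ts us i i∈t)

    height-[]* : ∀ {k n m} (ts : Vec (Term Γ k) m) (us : Vec (Term Γ n) k) i →
                 1 ≤ occurrences* i ts → height (lookup us i) ≤ height* (ts [ us ]*)
    height-[]* (t ∷ ts) us i i∈ts with occurrences i t in eq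
    ... | suc _ = ℕ.m≤n⇒m≤n⊔o (height* (ts [ us ]*))
                    (height-[] t us i (subst (1 ≤_) (sym eq) (s≤s z≤n)))
    ... | zero  = ℕ.m≤n⇒m≤o⊔n (height (t [ us ])) (height-[]* ts us i i∈ts)

lookup-map-≡ : ∀ {a b} {A : Set a} {B : Set b} {m} (f : A → B) (xs : Vec A m) i →
               lookup (Vec.map f xs) i ≡ f (lookup xs i)
lookup-map-≡ f (x ∷ xs) zero    = refl
lookup-map-≡ f (x ∷ xs) (suc i) = lookup-map-≡ f xs i

module _ {Λ Γ : RankedAlphabet} (h : TreeHom Λ Γ) (lin : Linear h) where

  mutual
    height-map : ∀ t → height t ≤ height (map h t)
    height-map (node g ts) rewrite map-node h g ts
      with image h g | lin g
    ... | node f us | _ , once = s≤s (height*-lub ts _ λ i →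
      ℕ.≤-trans (height-map* ts i)
        (ℕ.≤-trans (ℕ.≤-reflexive (cong height (sym (lookup-map-≡ (map h) ts i))))
          (height-[]* us (Vec.map (map h) ts) i (ℕ.≤-reflexive (sym (once i))))))

    height-map* : ∀ {m} (ts : Vec (Tree Λ) m) i →
                  height (lookup ts i) ≤ height (map h (lookup ts i))
    height-map* (t ∷ ts) zero    = height-map t
    height-map* (t ∷ ts) (suc i) = height-map* ts i

record Preimage {Λ Γ : RankedAlphabet} (h : TreeHom Λ Γ) (t : Tree Γ) : Set where
  field
    elements : List (Tree Λ)
    unique   : Unique elements
    member   : ∀ t' → t' ∈ elements ⇔ map h t' ≡ t

preimage : ∀ {Λ Γ} (h : TreeHom Λ Γ) → Linear h → ∀ t → Preimage h t
preimage h lin t = record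
  { elements = deduplicate _≟ᵗ_ candidates
  ; unique   = DecUnique.deduplicate-! _≟ᵗ_ candidates
  ; member   = λ t' → mk⇔
      (λ t'∈ → proj₂ (∈-filter⁻ hits? {xs = treesUpTo (height t)}
                        (∈-deduplicate⁻ _≟ᵗ_ candidates t'∈)))
      (λ ht'≡t → ∈-deduplicate⁺ _≟ᵗ_ (∈-filter⁺ hits?
        (∈-treesUpTo _ t' (subst (λ u → height t' ≤ height u) ht'≡t (height-map h lin t'))) ht'≡t))
  }
  where
  hits? : Decidable (λ t' → map h t' ≡ t)
  hits? t' = map h t' ≟ᵗ t

  candidates : List (Tree _)
  candidates = filter hits? (treesUpTo (height t))

module Weighted {c ℓ} (S : CommutativeSemiring c ℓ) where

  open CommutativeSemiring S
    using (Carrier; _≈_; 0#; 1#; rawSemiring)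
    renaming (_+_ to _⊕_; _*_ to _⊗_) public
  open RawSemiringDefs rawSemiring using (_^_; sum; product)

  sumOver : ∀ {a} {A : Set a} → List A → (A → Carrier) → Carrier
  sumOver xs f = foldr (λ x acc → f x ⊕ acc) 0# xs

  -- A polynomial in n indeterminates is written as a formal sum of terms: (c , e) stands for
  -- c · q₁^e₁ ⋯ qₙ^eₙ.  Different lists may denote the same element of S[Q], but polynomials
  -- enter only through `_⟨_⟩`, whose value depends only on the element denoted.
  Polynomial : ℕ → Set c
  Polynomial n = List (Carrier × Vec ℕ n)

  _⟨_⟩ : ∀ {n} → Polynomial n → (Fin n → Carrier) → Carrier
  p ⟨ s ⟩ = sumOver p (λ (a , e) → a ⊗ product (λ i → s i ^ lookup e i))

  record WAFA (A : Alphabet) : Set c where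
    field
      states     : ℕ
      transition : Fin states → Alphabet.Symbol A → Polynomial states
      initial    : Polynomial states
      terminal   : Fin states → Carrier

    stateBehavior : Word A → Fin states → Carrier
    stateBehavior []      q = terminal q
    stateBehavior (a ∷ v) q = transition q a ⟨ stateBehavior v ⟩

    behavior : Word A → Carrier
    behavior w = initial ⟨ stateBehavior w ⟩

  Recognizes : ∀ {A} → WAFA A → (Word A → Carrier) → Set ℓ
  Recognizes M s = ∀ w → WAFA.behavior M w ≈ s w

  record WFTA (Γ : RankedAlphabet) : Set c where
    field
      states     : ℕ
      transition : (g : Symbol Γ) → Vec (Fin states) (rank Γ g) → Fin states → Carrier
      root       : Fin states → Carrier

    mutual
      stateBehavior : Tree Γ → Fin states → Carrier
      stateBehavior (node g ts) q =
        sumOver (tuples (allFin states) (rank Γ g)) λ ps →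
          transition g ps q ⊗ product (λ i → lookup (stateBehaviors ts) i (lookup ps i))

      stateBehaviors : ∀ {k} → Vec (Tree Γ) k → Vec (Fin states → Carrier) k
      stateBehaviors []       = []
      stateBehaviors (t ∷ ts) = stateBehavior t ∷ stateBehaviors ts

    behavior : Tree Γ → Carrier
    behavior t = sum (λ q → root q ⊗ stateBehavior t q)

  𝟙 : ∀ {Γ} {L : Pred (Tree Γ) 0ℓ} → Decidable L → Tree Γ → Carrier
  𝟙 L? t = if does (L? t) then 1# else 0#

  _⊙_ : ∀ {Γ} → (Tree Γ → Carrier) → (Tree Γ → Carrier) → Tree Γ → Carrier
  (u ⊙ v) t = u t ⊗ v t

  pushforward : ∀ {Λ Γ} (h : TreeHom Λ Γ) → Linear h → (Tree Λ → Carrier) → Tree Γ → Carrier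
  pushforward h lin u t = sumOver (Preimage.elements (preimage h lin t)) u

{-# OPTIONS --safe #-}

-- Both directions rest on one recursion.  If ℬ is a WFTA over Λ with states q and F_q(w) is the
-- sum of its state behaviors over the preimages of t^r_w, then
--   F_q(w) = Σ_g Σ_p δ_g(p,q) · E(h(g))(w),
-- where E(u)(w) walks through the term u and through w simultaneously: it is 0 if u and t^r_w
-- clash, and otherwise the product of the F_{pᵢ}(v) over the variables xᵢ of u, v being the suffix
-- of w left over where xᵢ is met, at which all subtrees of t^r_w equal t^r_v.  By linearity of h the
-- sum over the tuples of subtrees distributes over that product.
-- A deterministic automaton for L times the one-state WFTA is such an ℬ, and its recursion is a
-- WAFA whose states are the subterms of the h(g).  Conversely the transitions of a WAFA, padded to
-- a common degree r, are the symbols of Λ, L is the set of runs, and the recursion for F_q becomes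
-- that of the state behaviors of the WAFA.

module Submission where

open import Algebra.Bundles using (CommutativeSemiring)
import Algebra.Definitions.RawSemiring as RawSemiringDefs
import Algebra.Properties.CommutativeMonoid.Sum as CommutativeMonoidSum
import Algebra.Properties.CommutativeSemigroup as CommutativeSemigroupProperties
open import Data.Bool.Base using (T; if_then_else_)
open import Data.Bool.Properties using (T?)
open import Data.Fin.Base using (Fin; zero; suc)
import Data.Fin.Base as Fin
import Data.Fin.Properties as Fin
open import Data.List.Base as List
  using (List; []; _∷_; _++_; allFin; cartesianProductWith; concatMap; filter; foldr; length)
import Data.List.Properties as List
import Data.List.Membership.DecPropositional as DecMembership
open import Data.List.Membership.Propositional using (_∈_; find; lose)
open import Data.List.Membership.Propositional.Properties
open import Data.List.Membership.Propositional.Properties.WithK using (unique∧set⇒bag)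
open import Data.List.Relation.Binary.BagAndSetEquality using (∼bag⇒↭)
open import Data.List.Relation.Binary.Permutation.Propositional as Perm using (_↭_)
open import Data.List.Relation.Unary.All as All using ([]; _∷_)
open import Data.List.Relation.Unary.AllPairs as AllPairs using ([]; _∷_)
import Data.List.Relation.Unary.AllPairs.Properties as AllPairs
import Data.List.Relation.Unary.All.Properties as All
open import Data.List.Relation.Unary.Any as Any using (here; there)
import Data.List.Relation.Unary.Any.Properties as Any
open import Data.List.Relation.Unary.Unique.Propositional using (Unique)
import Data.List.Relation.Unary.Unique.Propositional.Properties as Unique
open import Data.Maybe.Base using (just; nothing)
open import Data.Nat.Base as ℕ using (ℕ; zero; suc; _≤_; _⊔_; z≤n; s≤s)
import Data.Nat.Properties as ℕ
open import Data.Product.Base using (Σ-syntax; ∃-syntax; _×_; _,_; proj₁; proj₂)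
open import Data.Sum.Base using (inj₁; inj₂)
open import Data.Vec.Base as Vec using (Vec; []; _∷_; lookup; replicate)
open import Data.Vec.Relation.Binary.Pointwise.Inductive as Pointwise using (Pointwise; []; _∷_)
import Data.Vec.Properties as Vec
open import Function.Base using (_∘_; id)
open import Function.Bundles using (_⇔_; mk⇔; Inverse; Equivalence)
import Function.Properties.Equivalence as ⇔
open import Function.Construct.Identity using (↔-id)
open import Level using (0ℓ)
open import Relation.Binary.PropositionalEquality as ≡ using (_≡_; _≢_; refl; cong; cong₂; subst)
open import Relation.Nullary using (¬_; Dec; yes; no; does; contradiction)
open import Relation.Nullary.Decidable
  using (map′; _×-dec_; ⌊_⌋; toWitness; fromWitness; does-⇔)
open import Relation.Unary using (Pred; Decidable)
open import Defs

open RankedAlphabet using (Symbol; rank; allSymbols)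

-- Both halves of linearity are used. That every image contains a symbol and every variable bounds
-- the height of preimages, so that one finite list of trees serves a word and all its suffixes.
-- That no variable is repeated makes the indicator of a match multilinear in the subtrees. The
-- symbol in each image has a second use: every unfolding of an equation consumes a letter, which is
-- what lets a WAFA follow the recursion. Addition in `S` need not be idempotent. A characteristic
-- function can therefore be exchanged for a sum over runs only if an accepted tree has a single
-- accepting run, and the given automaton has to be determinised before it is combined with the
-- weights. In the other direction the copies of a subtree in the word tree are what alternation
-- becomes: a monomial multiplies state values at one and the same suffix. The choice among the
-- monomials of a transition becomes the choice among preimages, so the sum over preimages supplies
-- the addition and one state is enough to multiply the coefficients.

-- Finite sums and indicators in a commutative semiring

module Sums {c ℓ} (S : CommutativeSemiring c ℓ) where

  open CommutativeSemiring S
    using (setoid; reflexive; +-cong; +-identityˡ; +-identityʳ; +-assoc; *-cong; *-congˡ; *-congʳ;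
           *-identityˡ; *-identityʳ; zeroˡ; zeroʳ; distribˡ; distribʳ; *-comm; *-assoc)
    renaming (refl to ≈-refl; sym to ≈-sym; trans to ≈-trans) public
  open CommutativeSemiring S using (rawSemiring; *-commutativeMonoid; *-commutativeSemigroup;
    +-commutativeSemigroup)
  open RawSemiringDefs rawSemiring using (_^_; product) public
  open Weighted S
  open import Relation.Binary.Reasoning.Setoid setoid

  module +P = CommutativeSemigroupProperties +-commutativeSemigroup
  module *P = CommutativeSemigroupProperties *-commutativeSemigroup
  module ∏P = CommutativeMonoidSum *-commutativeMonoid

  module _ {a} {A : Set a} where

    sumOver-cong-∈ : ∀ (xs : List A) {f g : A → Carrier} → (∀ {x} → x ∈ xs → f x ≈ g x) →
                     sumOver xs f ≈ sumOver xs g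
    sumOver-cong-∈ []       f≈g = ≈-refl
    sumOver-cong-∈ (x ∷ xs) f≈g = +-cong (f≈g (here refl)) (sumOver-cong-∈ xs (f≈g ∘ there))

    sumOver-cong : ∀ (xs : List A) {f g : A → Carrier} → (∀ x → f x ≈ g x) →
                   sumOver xs f ≈ sumOver xs g
    sumOver-cong xs f≈g = sumOver-cong-∈ xs (λ {x} _ → f≈g x)

    sumOver-zero : ∀ (xs : List A) {f : A → Carrier} → (∀ {x} → x ∈ xs → f x ≈ 0#) →
                   sumOver xs f ≈ 0#
    sumOver-zero []       f≈0 = ≈-refl
    sumOver-zero (x ∷ xs) f≈0 =
      ≈-trans (+-cong (f≈0 (here refl)) (sumOver-zero xs (f≈0 ∘ there))) (+-identityˡ 0#)

    sumOver-++ : ∀ (xs ys : List A) (f : A → Carrier) →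
                 sumOver (xs ++ ys) f ≈ sumOver xs f ⊕ sumOver ys f
    sumOver-++ []       ys f = ≈-sym (+-identityˡ _)
    sumOver-++ (x ∷ xs) ys f = ≈-trans (+-cong ≈-refl (sumOver-++ xs ys f)) (≈-sym (+-assoc _ _ _))

    sumOver-⊕ : ∀ (xs : List A) (f g : A → Carrier) →
                sumOver xs (λ x → f x ⊕ g x) ≈ sumOver xs f ⊕ sumOver xs g
    sumOver-⊕ []       f g = ≈-sym (+-identityˡ 0#)
    sumOver-⊕ (x ∷ xs) f g = ≈-trans (+-cong ≈-refl (sumOver-⊕ xs f g)) (+P.interchange _ _ _ _)

    sumOver-⊗ˡ : ∀ (xs : List A) k (f : A → Carrier) →
                 k ⊗ sumOver xs f ≈ sumOver xs (λ x → k ⊗ f x)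
    sumOver-⊗ˡ []       k f = zeroʳ k
    sumOver-⊗ˡ (x ∷ xs) k f = ≈-trans (distribˡ k _ _) (+-cong ≈-refl (sumOver-⊗ˡ xs k f))

    sumOver-⊗ʳ : ∀ (xs : List A) k (f : A → Carrier) →
                 sumOver xs f ⊗ k ≈ sumOver xs (λ x → f x ⊗ k)
    sumOver-⊗ʳ []       k f = zeroˡ k
    sumOver-⊗ʳ (x ∷ xs) k f = ≈-trans (distribʳ k _ _) (+-cong ≈-refl (sumOver-⊗ʳ xs k f))

    sumOver-↭ : ∀ {xs ys : List A} → xs ↭ ys → (f : A → Carrier) → sumOver xs f ≈ sumOver ys f
    sumOver-↭ Perm.refl         f = ≈-refl
    sumOver-↭ (Perm.prep x p)   f = +-cong ≈-refl (sumOver-↭ p f)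
    sumOver-↭ (Perm.swap x y p) f =
      ≈-trans (+P.x∙yz≈y∙xz _ _ _) (+-cong ≈-refl (+-cong ≈-refl (sumOver-↭ p f)))
    sumOver-↭ (Perm.trans p q)  f = ≈-trans (sumOver-↭ p f) (sumOver-↭ q f)

  module _ {a b} {A : Set a} {B : Set b} where

    sumOver-map : ∀ (xs : List A) (g : A → B) (f : B → Carrier) →
                  sumOver (List.map g xs) f ≡ sumOver xs (f ∘ g)
    sumOver-map xs g f = List.foldr-map _ g 0# xs

    sumOver-concatMap : ∀ (xs : List A) (g : A → List B) (f : B → Carrier) →
                        sumOver (concatMap g xs) f ≈ sumOver xs (λ x → sumOver (g x) f)
    sumOver-concatMap []       g f = ≈-refl
    sumOver-concatMap (x ∷ xs) g f =
      ≈-trans (sumOver-++ (g x) (concatMap g xs) f) (+-cong ≈-refl (sumOver-concatMap xs g f))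

    sumOver-swap : ∀ (xs : List A) (ys : List B) (f : A → B → Carrier) →
      sumOver xs (λ x → sumOver ys (f x)) ≈ sumOver ys (λ y → sumOver xs (λ x → f x y))
    sumOver-swap []       ys f = ≈-sym (sumOver-zero ys (λ _ → ≈-refl))
    sumOver-swap (x ∷ xs) ys f =
      ≈-trans (+-cong ≈-refl (sumOver-swap xs ys f)) (≈-sym (sumOver-⊕ ys _ _))

    sumOver-product : ∀ (xs : List A) (ys : List B) (f : A → Carrier) (g : B → Carrier) →
      sumOver xs f ⊗ sumOver ys g ≈ sumOver xs (λ x → sumOver ys (λ y → f x ⊗ g y))
    sumOver-product xs ys f g =
      ≈-trans (sumOver-⊗ʳ xs _ f) (sumOver-cong xs (λ x → sumOver-⊗ˡ ys (f x) g))

  sumOver-cartesianProductWith :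
    ∀ {a b d} {A : Set a} {B : Set b} {D : Set d} (h : A → B → D) xs ys (f : D → Carrier) →
    sumOver (cartesianProductWith h xs ys) f ≈ sumOver xs (λ x → sumOver ys (λ y → f (h x y)))
  sumOver-cartesianProductWith h []       ys f = ≈-refl
  sumOver-cartesianProductWith h (x ∷ xs) ys f =
    ≈-trans (sumOver-++ (List.map (h x) ys) _ f)
      (+-cong (reflexive (sumOver-map ys (h x) f)) (sumOver-cartesianProductWith h xs ys f))

  -- The Iverson bracket with values in the semiring. Being defined through `does`, it agrees with
  -- `𝟙` by computation.
  ⟦_⟧ : ∀ {p} {P : Set p} → Dec P → Carrier
  ⟦ d ⟧ = if does d then 1# else 0#

  module _ {p} {P : Set p} where

    ⟦⟧-yes : (d : Dec P) → P → ⟦ d ⟧ ≡ 1#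
    ⟦⟧-yes (yes _) _ = refl
    ⟦⟧-yes (no ¬p) p = contradiction p ¬p

    ⟦⟧-no : (d : Dec P) → ¬ P → ⟦ d ⟧ ≡ 0#
    ⟦⟧-no (yes p) ¬p = contradiction p ¬p
    ⟦⟧-no (no _)  _  = refl

  module _ {p q} {P : Set p} {Q : Set q} where

    ⟦⟧-cong : (d : Dec P) (e : Dec Q) → P ⇔ Q → ⟦ d ⟧ ≡ ⟦ e ⟧
    ⟦⟧-cong (yes p) e P⇔Q = ≡.sym (⟦⟧-yes e (Equivalence.to P⇔Q p))
    ⟦⟧-cong (no ¬p) e P⇔Q = ≡.sym (⟦⟧-no e (¬p ∘ Equivalence.from P⇔Q))

    ⟦⟧-× : (d : Dec P) (e : Dec Q) → ⟦ d ×-dec e ⟧ ≈ ⟦ d ⟧ ⊗ ⟦ e ⟧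
    ⟦⟧-× (yes _) e = ≈-sym (*-identityˡ _)
    ⟦⟧-× (no _)  e = ≈-sym (zeroˡ _)

  module _ {a p} {A : Set a} {P : Pred A p} (P? : Decidable P) (f : A → Carrier) where

    sumOver-filter : ∀ xs → sumOver (filter P? xs) f ≈ sumOver xs (λ x → ⟦ P? x ⟧ ⊗ f x)
    sumOver-filter []       = ≈-refl
    sumOver-filter (x ∷ xs) with P? x
    ... | yes _ = +-cong (≈-sym (*-identityˡ _)) (sumOver-filter xs)
    ... | no  _ = ≈-trans (sumOver-filter xs)
                    (≈-trans (≈-sym (+-identityˡ _)) (+-cong (≈-sym (zeroˡ _)) ≈-refl))

    sumOver-none : ∀ xs → (∀ {x} → x ∈ xs → ¬ P x) → sumOver xs (λ x → ⟦ P? x ⟧ ⊗ f x) ≈ 0#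
    sumOver-none xs ¬P = sumOver-zero xs λ {x} x∈xs →
      ≈-trans (*-congʳ (reflexive (⟦⟧-no (P? x) (¬P x∈xs)))) (zeroˡ _)

    -- Uniqueness of the list is essential: a repeated `x` would contribute a multiple of `f x`. All
    -- lists summed over are therefore shown to be free of duplicates.
    sumOver-single : ∀ {x xs} → Unique xs → x ∈ xs → P x → (∀ {y} → P y → y ≡ x) →
                     sumOver xs (λ y → ⟦ P? y ⟧ ⊗ f y) ≈ f x
    sumOver-single {x} {_ ∷ xs} (x∉xs ∷ _) (here refl) Px only = begin
      ⟦ P? x ⟧ ⊗ f x ⊕ sumOver xs (λ y → ⟦ P? y ⟧ ⊗ f y)
        ≈⟨ +-cong (*-congʳ (reflexive (⟦⟧-yes (P? x) Px)))
             (sumOver-none xs λ y∈xs Py → All.lookup x∉xs y∈xs (≡.sym (only Py))) ⟩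
      1# ⊗ f x ⊕ 0#  ≈⟨ +-identityʳ _ ⟩
      1# ⊗ f x       ≈⟨ *-identityˡ _ ⟩
      f x            ∎
    sumOver-single {x} {z ∷ xs} (z∉xs ∷ u) (there x∈xs) Px only = begin
      ⟦ P? z ⟧ ⊗ f z ⊕ sumOver xs (λ y → ⟦ P? y ⟧ ⊗ f y)
        ≈⟨ +-cong (*-congʳ (reflexive (⟦⟧-no (P? z) λ Pz → All.lookup z∉xs x∈xs (only Pz))))
             (sumOver-single u x∈xs Px only) ⟩
      0# ⊗ f z ⊕ f x ≈⟨ +-cong (zeroˡ _) ≈-refl ⟩
      0# ⊕ f x       ≈⟨ +-identityˡ _ ⟩
      f x            ∎

  -- Products over lists and monomials

  prodOver : ∀ {a} {A : Set a} → List A → (A → Carrier) → Carrier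
  prodOver xs f = foldr (λ x acc → f x ⊗ acc) 1# xs

  module _ {a} {A : Set a} (f : A → Carrier) where

    prodOver-++ : ∀ xs ys → prodOver (xs ++ ys) f ≈ prodOver xs f ⊗ prodOver ys f
    prodOver-++ []       ys = ≈-sym (*-identityˡ _)
    prodOver-++ (x ∷ xs) ys = ≈-trans (*-congˡ (prodOver-++ xs ys)) (≈-sym (*-assoc _ _ _))

    prodOver-replicate : ∀ n x → prodOver (List.replicate n x) f ≡ f x ^ n
    prodOver-replicate zero    x = refl
    prodOver-replicate (suc n) x = cong (f x ⊗_) (prodOver-replicate n x)

    prodOver-map : ∀ {b} {B : Set b} (g : B → A) xs →
                   prodOver (List.map g xs) f ≡ prodOver xs (f ∘ g)
    prodOver-map g xs = List.foldr-map _ g 1# xs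

  prodOver-cong : ∀ {a} {A : Set a} (xs : List A) {f g : A → Carrier} →
                  (∀ {x} → x ∈ xs → f x ≈ g x) → prodOver xs f ≈ prodOver xs g
  prodOver-cong []       f≈g = ≈-refl
  prodOver-cong (x ∷ xs) f≈g = *-cong (f≈g (here refl)) (prodOver-cong xs (f≈g ∘ there))

  monomial : ∀ {n} → (Fin n → Carrier) → Vec ℕ n → Carrier
  monomial s e = product (λ i → s i ^ lookup e i)

  -- As a list with repetitions a monomial is multiplied by concatenation and can be padded to a
  -- prescribed length.
  factors : ∀ {n} → Vec ℕ n → List (Fin n)
  factors []      = []
  factors (k ∷ e) = List.replicate k zero ++ List.map suc (factors e)

  monomial-factors : ∀ {n} (s : Fin n → Carrier) e → monomial s e ≈ prodOver (factors e) s
  monomial-factors s []      = ≈-refl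
  monomial-factors s (k ∷ e) = begin
    s zero ^ k ⊗ monomial (s ∘ suc) e
      ≈⟨ *-cong (reflexive (≡.sym (prodOver-replicate s k zero))) (monomial-factors (s ∘ suc) e) ⟩
    prodOver (List.replicate k zero) s ⊗ prodOver (factors e) (s ∘ suc)
      ≡⟨ cong (prodOver (List.replicate k zero) s ⊗_) (prodOver-map s suc (factors e)) ⟨
    prodOver (List.replicate k zero) s ⊗ prodOver (List.map suc (factors e)) s
      ≈⟨ prodOver-++ s (List.replicate k zero) _ ⟨
    prodOver (factors (k ∷ e)) s ∎

  -- The way back to exponent vectors, for monomials that arise as lists of subterms. Repeated
  -- subterms are counted, giving powers.
  exponents : ∀ {n} → List (Fin n) → Vec ℕ n
  exponents []      = replicate _ 0
  exponents (i ∷ l) = Vec.updateAt (exponents l) i suc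

  monomial-updateAt : ∀ {n} (s : Fin n → Carrier) e i →
                      monomial s (Vec.updateAt e i suc) ≈ s i ⊗ monomial s e
  monomial-updateAt s (k ∷ e) zero    = *-assoc _ _ _
  monomial-updateAt s (k ∷ e) (suc i) =
    ≈-trans (*-congˡ (monomial-updateAt (s ∘ suc) e i)) (*P.x∙yz≈y∙xz _ _ _)

  monomial-exponents : ∀ {n} (s : Fin n → Carrier) l → monomial s (exponents l) ≈ prodOver l s
  monomial-exponents {zero}  s []      = ≈-refl
  monomial-exponents {suc n} s []      =
    ≈-trans (*-identityˡ _) (monomial-exponents (s ∘ suc) [])
  monomial-exponents s (i ∷ l) =
    ≈-trans (monomial-updateAt s (exponents l) i) (*-congˡ (monomial-exponents s l))

-- Enumerations of tuples, symbols and trees without duplicates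

tuples-unique : ∀ {a} {A : Set a} {xs : List A} → Unique xs → ∀ k → Unique (tuples xs k)
tuples-unique u zero    = [] ∷ []
tuples-unique u (suc k) =
  Unique.cartesianProductWith⁺ _∷_ (λ { refl → refl , refl }) u (tuples-unique u k)

∈-tuples⁺ : ∀ {a} {A : Set a} {xs : List A} → (∀ x → x ∈ xs) → ∀ {k} (v : Vec A k) →
            v ∈ tuples xs k
∈-tuples⁺ all []      = here refl
∈-tuples⁺ all (x ∷ v) = ∈-cartesianProductWith⁺ _∷_ (all x) (∈-tuples⁺ all v)

concatMap-unique : ∀ {a b} {A : Set a} {B : Set b} (f : A → List B) {xs} → Unique xs →
                   (∀ x → Unique (f x)) → (∀ {x y z} → z ∈ f x → z ∈ f y → x ≡ y) →
                   Unique (concatMap f xs)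
concatMap-unique f {xs} u uf disj = Unique.concat⁺
  (All.map⁺ (All.tabulate (λ {x} _ → uf x)))
  (AllPairs.map⁺ (AllPairs.map (λ { x≢y (z∈x , z∈y) → x≢y (disj z∈x z∈y) }) u))

allSymbols-unique : ∀ A → Unique (Alphabet.allSymbols A)
allSymbols-unique A = Unique.map⁺ injective (Unique.allFin⁺ _)
  where
  open Inverse (Alphabet.finite A)
  injective : ∀ {i j} → from i ≡ from j → i ≡ j
  injective {i} {j} eq =
    ≡.trans (≡.sym (strictlyInverseˡ i)) (≡.trans (cong to eq) (strictlyInverseˡ j))

node-injective : ∀ {Γ n g} {ts us : Vec (Term Γ n) (rank Γ g)} → node g ts ≡ node g us → ts ≡ us
node-injective refl = refl

-- Root symbol and children are determined by the tree, so the blocks for different symbols are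
-- disjoint and no block repeats a tree.
treesUpTo-unique : ∀ {Γ} b → Unique (treesUpTo {Γ} b)
treesUpTo-unique zero = []
treesUpTo-unique {Γ} (suc b) = concatMap-unique _ (allSymbols-unique (RankedAlphabet.alphabet Γ))
  (λ g → Unique.map⁺ node-injective (tuples-unique (treesUpTo-unique b) (rank Γ g)))
  sameRoot
  where
  sameRoot : ∀ {f g t} → t ∈ List.map (node f) (tuples (treesUpTo b) (rank Γ f)) →
             t ∈ List.map (node g) (tuples (treesUpTo b) (rank Γ g)) → f ≡ g
  sameRoot t∈f t∈g with ∈-map⁻ (node _) t∈f | ∈-map⁻ (node _) t∈g
  ... | _ , _ , refl | _ , _ , refl = refl

-- Matching a term against the tree of a word

module Matching {c ℓ} (S : CommutativeSemiring c ℓ) (A : Alphabet) (r : ℕ) where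

  open Weighted S
  open Sums S
  open Alphabet A using (_≟_)
  open import Relation.Binary.Reasoning.Setoid setoid

  Γ : RankedAlphabet
  Γ = Ranked# A r

  Series : Set c
  Series = Word A → Carrier

  -- For θ i v = ⟦ tᵢ = t^r_v ⟧ this is the indicator of u⟨t₁,…,tₖ⟩ = t^r_w (`eval-match`).
  -- For linear u it is linear in each θ i, so that it commutes with sums over the tᵢ.
  mutual
    eval : ∀ {k} → (Fin k → Series) → Term Γ k → Series
    eval θ (var i)            w       = θ i w
    eval θ (node nothing _)   []      = 1#
    eval θ (node nothing _)   (_ ∷ _) = 0#
    eval θ (node (just b) us) []      = 0#
    eval θ (node (just b) us) (a ∷ v) = ⟦ b ≟ a ⟧ ⊗ evalAll θ us v

    evalAll : ∀ {k m} → (Fin k → Series) → Vec (Term Γ k) m → Series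
    evalAll θ []       v = 1#
    evalAll θ (u ∷ us) v = eval θ u v ⊗ evalAll θ us v

  module _ {k l} (θ : Fin l → Series) (ts : Vec (Term Γ l) k) where

    mutual
      eval-[] : ∀ u w → eval θ (u [ ts ]) w ≡ eval (λ i → eval θ (lookup ts i)) u w
      eval-[] (var i)            w       = refl
      eval-[] (node nothing _)   []      = refl
      eval-[] (node nothing _)   (_ ∷ _) = refl
      eval-[] (node (just b) us) []      = refl
      eval-[] (node (just b) us) (a ∷ v) = cong (⟦ b ≟ a ⟧ ⊗_) (evalAll-[] us v)

      evalAll-[] : ∀ {m} (us : Vec (Term Γ k) m) v →
                   evalAll θ (us [ ts ]*) v ≡ evalAll (λ i → eval θ (lookup ts i)) us v
      evalAll-[] []       v = refl
      evalAll-[] (u ∷ us) v = cong₂ _⊗_ (eval-[] u v) (evalAll-[] us v)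

  module _ {k} {θ θ′ : Fin k → Series} {n} (θ≈ : ∀ i v → length v ≤ n → θ i v ≈ θ′ i v) where

    mutual
      -- The length bound is the point of the statement. Only suffixes of `w` ever reach the
      -- variables, and the enumeration of trees in `stateSeries-recursion` yields the right series
      -- for the children only at words no longer than `w`.
      eval-cong : ∀ u w → length w ≤ n → eval θ u w ≈ eval θ′ u w
      eval-cong (var i)            w       w≤n = θ≈ i w w≤n
      eval-cong (node nothing _)   []      w≤n = ≈-refl
      eval-cong (node nothing _)   (_ ∷ _) w≤n = ≈-refl
      eval-cong (node (just b) us) []      w≤n = ≈-refl
      eval-cong (node (just b) us) (a ∷ v) w≤n = *-congˡ (evalAll-cong us v (ℕ.<⇒≤ w≤n))

      evalAll-cong : ∀ {m} (us : Vec (Term Γ k) m) v → length v ≤ n →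
                     evalAll θ us v ≈ evalAll θ′ us v
      evalAll-cong []       v v≤n = ≈-refl
      evalAll-cong (u ∷ us) v v≤n = *-cong (eval-cong u v v≤n) (evalAll-cong us v v≤n)

  hits : Tree Γ → Series
  hits t w = ⟦ t ≟ᵗ wordTree A r w ⟧

  node-≡ : ∀ {k b a} {us vs : Vec (Term Γ k) r} →
           (b ≡ a × us ≡ vs) ⇔ (node (just b) us ≡ node (just a) vs)
  node-≡ = mk⇔ (λ { (refl , refl) → refl }) (λ { refl → refl , refl })

  module _ {k} (ts : Vec (Tree Γ) k) where

    mutual
      -- All children of a letter in the word tree are the same tree. Equality at a node is thus a
      -- conjunction that compares every argument with that one tree, and the bracket turns the
      -- conjunction into the product `evalAll`.
      eval-match : ∀ u w → eval (λ i → hits (lookup ts i)) u w ≈ hits (u [ ts ]) w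
      eval-match (var i)            w       = ≈-refl
      eval-match (node nothing [])  []      = ≈-refl
      eval-match (node nothing _)   (_ ∷ _) = ≈-refl
      eval-match (node (just b) us) []      = ≈-refl
      eval-match (node (just b) us) (a ∷ v) = begin
        ⟦ b ≟ a ⟧ ⊗ evalAll (λ i → hits (lookup ts i)) us v
          ≈⟨ *-congˡ (evalAll-match us v) ⟩
        ⟦ b ≟ a ⟧ ⊗ ⟦ (us [ ts ]*) ≟* replicate r (wordTree A r v) ⟧
          ≈⟨ ⟦⟧-× (b ≟ a) ((us [ ts ]*) ≟* replicate r (wordTree A r v)) ⟨
        ⟦ b ≟ a ×-dec (us [ ts ]*) ≟* replicate r (wordTree A r v) ⟧
          ≡⟨ ⟦⟧-cong (b ≟ a ×-dec (us [ ts ]*) ≟* replicate r (wordTree A r v))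
               (node (just b) (us [ ts ]*) ≟ᵗ wordTree A r (a ∷ v))
               node-≡ ⟩
        hits (node (just b) (us [ ts ]*)) (a ∷ v) ∎

      evalAll-match : ∀ {m} (us : Vec (Term Γ k) m) v →
        evalAll (λ i → hits (lookup ts i)) us v ≈ ⟦ (us [ ts ]*) ≟* replicate m (wordTree A r v) ⟧
      evalAll-match []       v = ≈-refl
      evalAll-match {suc m} (u ∷ us) v = ≈-trans
        (*-cong (eval-match u v) (evalAll-match us v))
        (≈-sym (⟦⟧-× ((u [ ts ]) ≟ᵗ wordTree A r v) ((us [ ts ]*) ≟* replicate m (wordTree A r v))))

  module _ {k} (θs : Vec Series k) (i : Fin k) (θ : Series) where

    mutual
      eval-const : ∀ u w → occurrences i u ≡ 0 →
                   eval (lookup (θs Vec.[ i ]≔ θ)) u w ≡ eval (lookup θs) u w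
      eval-const (var j) w _ with i Fin.≟ j
      ... | no i≢j = cong (λ η → η w) (Vec.lookup∘updateAt′ j i (i≢j ∘ ≡.sym) θs)
      eval-const (node nothing _)   []      _  = refl
      eval-const (node nothing _)   (_ ∷ _) _  = refl
      eval-const (node (just b) us) []      _  = refl
      eval-const (node (just b) us) (a ∷ v) eq = cong (⟦ b ≟ a ⟧ ⊗_) (evalAll-const us v eq)

      evalAll-const : ∀ {m} (us : Vec (Term Γ k) m) v → occurrences* i us ≡ 0 →
                      evalAll (lookup (θs Vec.[ i ]≔ θ)) us v ≡ evalAll (lookup θs) us v
      evalAll-const []       v _  = refl
      evalAll-const (u ∷ us) v eq = cong₂ _⊗_
        (eval-const u v (ℕ.m+n≡0⇒m≡0 (occurrences i u) eq))
        (evalAll-const us v (ℕ.m+n≡0⇒n≡0 (occurrences i u) eq))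

  module _ {x} {X : Set x} (xs : List X) where

    combination : (X → Carrier) → (X → Series) → Series
    combination κ θ w = sumOver xs (λ x → κ x ⊗ θ x w)

    module _ {k} (θs : Vec Series k) (i : Fin k) (κ : X → Carrier) (θ : X → Series) where

      mutual
        -- In each product exactly one factor contains the variable. The sum is pulled out of that
        -- factor, and the others do not change by `eval-const`. Two occurrences would produce a
        -- product of two sums instead.
        eval-linear : ∀ u w → occurrences i u ≡ 1 →
          eval (lookup (θs Vec.[ i ]≔ combination κ θ)) u w
            ≈ combination κ (λ x → eval (lookup (θs Vec.[ i ]≔ θ x)) u) w
        eval-linear (var j) w _ with i Fin.≟ j
        ... | yes refl = begin
          lookup (θs Vec.[ i ]≔ combination κ θ) i w
            ≡⟨ cong (λ η → η w) (Vec.lookup∘updateAt i θs) ⟩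
          combination κ θ w
            ≈⟨ sumOver-cong xs (λ x → *-congˡ (reflexive
                 (cong (λ η → η w) (Vec.lookup∘updateAt i θs)))) ⟨
          combination κ (λ x → lookup (θs Vec.[ i ]≔ θ x) i) w ∎
        eval-linear (node nothing [])  w       ()
        eval-linear (node (just b) us) []      _  =
          ≈-sym (sumOver-zero xs (λ _ → zeroʳ _))
        eval-linear (node (just b) us) (a ∷ v) eq = begin
          ⟦ b ≟ a ⟧ ⊗ evalAll (lookup (θs Vec.[ i ]≔ combination κ θ)) us v
            ≈⟨ *-congˡ (evalAll-linear us v eq) ⟩
          ⟦ b ≟ a ⟧ ⊗ combination κ (λ x → evalAll (lookup (θs Vec.[ i ]≔ θ x)) us) v
            ≈⟨ sumOver-⊗ˡ xs _ _ ⟩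
          sumOver xs (λ x → ⟦ b ≟ a ⟧ ⊗ (κ x ⊗ evalAll (lookup (θs Vec.[ i ]≔ θ x)) us v))
            ≈⟨ sumOver-cong xs (λ x → *P.x∙yz≈y∙xz _ _ _) ⟩
          combination κ (λ x → eval (lookup (θs Vec.[ i ]≔ θ x)) (node (just b) us)) (a ∷ v) ∎

        evalAll-linear : ∀ {m} (us : Vec (Term Γ k) m) v → occurrences* i us ≡ 1 →
          evalAll (lookup (θs Vec.[ i ]≔ combination κ θ)) us v
            ≈ combination κ (λ x → evalAll (lookup (θs Vec.[ i ]≔ θ x)) us) v
        evalAll-linear (u ∷ us) v eq with occurrences i u in eqᵤ
        ... | zero = begin
          eval (lookup (θs Vec.[ i ]≔ combination κ θ)) u v ⊗
          evalAll (lookup (θs Vec.[ i ]≔ combination κ θ)) us v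
            ≈⟨ *-cong (reflexive (eval-const θs i _ u v eqᵤ)) (evalAll-linear us v eq) ⟩
          eval (lookup θs) u v ⊗ combination κ (λ x → evalAll (lookup (θs Vec.[ i ]≔ θ x)) us) v
            ≈⟨ sumOver-⊗ˡ xs _ _ ⟩
          sumOver xs (λ x → eval (lookup θs) u v ⊗
            (κ x ⊗ evalAll (lookup (θs Vec.[ i ]≔ θ x)) us v))
            ≈⟨ sumOver-cong xs (λ x → ≈-trans (*P.x∙yz≈y∙xz _ _ _) (*-congˡ (*-congʳ
                 (reflexive (≡.sym (eval-const θs i (θ x) u v eqᵤ)))))) ⟩
          combination κ (λ x → evalAll (lookup (θs Vec.[ i ]≔ θ x)) (u ∷ us)) v ∎
        ... | suc zero = begin
          eval (lookup (θs Vec.[ i ]≔ combination κ θ)) u v ⊗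
          evalAll (lookup (θs Vec.[ i ]≔ combination κ θ)) us v
            ≈⟨ *-cong (eval-linear u v eqᵤ) (reflexive (evalAll-const θs i _ us v us≡0)) ⟩
          combination κ (λ x → eval (lookup (θs Vec.[ i ]≔ θ x)) u) v ⊗ evalAll (lookup θs) us v
            ≈⟨ sumOver-⊗ʳ xs _ _ ⟩
          sumOver xs (λ x → κ x ⊗ eval (lookup (θs Vec.[ i ]≔ θ x)) u v ⊗ evalAll (lookup θs) us v)
            ≈⟨ sumOver-cong xs (λ x → ≈-trans (*-assoc _ _ _) (*-congˡ (*-congˡ
                 (reflexive (≡.sym (evalAll-const θs i (θ x) us v us≡0)))))) ⟩
          combination κ (λ x → evalAll (lookup (θs Vec.[ i ]≔ θ x)) (u ∷ us)) v ∎
          where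
          us≡0 : occurrences* i us ≡ 0
          us≡0 = ℕ.suc-injective eq

    -- Distributivity of sums over products for an abstract multilinear `F`. The induction fixes the
    -- first slot, after which `F (θ x ∷ _)` is again linear in every remaining slot. The
    -- coefficients `κs` depend on the slot because each subtree is weighted by the behavior at its
    -- own state.
    multilinear-sum : ∀ {k} (F : Vec Series k → Carrier) →
      (∀ θs i κ θ → F (θs Vec.[ i ]≔ combination κ θ)
                      ≈ sumOver xs (λ x → κ x ⊗ F (θs Vec.[ i ]≔ θ x))) →
      (κs : Vec (X → Carrier) k) (θ : X → Series) →
      sumOver (tuples xs k) (λ ts → product (λ i → lookup κs i (lookup ts i)) ⊗ F (Vec.map θ ts))
        ≈ F (Vec.map (λ κ → combination κ θ) κs)
    multilinear-sum F lin []       θ = ≈-trans (+-identityʳ _) (*-identityˡ _)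
    multilinear-sum {suc k} F lin (κ ∷ κs) θ = begin
      sumOver (tuples xs (suc k)) (λ ts → product (λ i → lookup (κ ∷ κs) i (lookup ts i)) ⊗
                                          F (Vec.map θ ts))
        ≈⟨ sumOver-cartesianProductWith _∷_ xs (tuples xs k) _ ⟩
      sumOver xs (λ x → sumOver (tuples xs k) (λ ts →
        κ x ⊗ product (λ i → lookup κs i (lookup ts i)) ⊗ F (θ x ∷ Vec.map θ ts)))
        ≈⟨ sumOver-cong xs (λ x → ≈-trans (sumOver-cong (tuples xs k) (λ ts → *-assoc _ _ _))
             (≈-sym (sumOver-⊗ˡ (tuples xs k) _ _))) ⟩
      sumOver xs (λ x → κ x ⊗ sumOver (tuples xs k) (λ ts →
        product (λ i → lookup κs i (lookup ts i)) ⊗ F (θ x ∷ Vec.map θ ts)))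
        ≈⟨ sumOver-cong xs (λ x → *-congˡ (multilinear-sum (λ θs → F (θ x ∷ θs))
             (λ θs i → lin (θ x ∷ θs) (suc i)) κs θ)) ⟩
      sumOver xs (λ x → κ x ⊗ F (θ x ∷ Vec.map (λ κ → combination κ θ) κs))
        ≈⟨ lin (combination κ θ ∷ Vec.map (λ κ → combination κ θ) κs) zero κ θ ⟨
      F (combination κ θ ∷ Vec.map (λ κ → combination κ θ) κs) ∎

-- Sums over the preimages of a word tree

wordTree-height : ∀ A r w → height (wordTree A r w) ≤ suc (length w)
wordTree-height A r []      = s≤s z≤n
wordTree-height A r (a ∷ v) = s≤s (replicate-height r)
  where
  replicate-height : ∀ m → height* (replicate m (wordTree A r v)) ≤ suc (length v)
  replicate-height zero    = z≤n
  replicate-height (suc m) = ℕ.⊔-lub (wordTree-height A r v) (replicate-height m)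

module StateSeries {c ℓ} (S : CommutativeSemiring c ℓ) (A : Alphabet) (r : ℕ)
                   {Λ : RankedAlphabet} (h : TreeHom Λ (Ranked# A r)) (linear : Linear h) where

  open Weighted S
  open Sums S
  open Matching S A r
  open TreeHom h
  open import Relation.Binary.Reasoning.Setoid setoid

  -- The list of preimages depends on the word, whereas the recursion compares sums at `w` and at
  -- its suffixes. Here all of them range over one list, with the match as an indicator. Two
  -- duplicate-free lists with the same elements are permutations of each other, which is all that a
  -- sum can see.
  pushforward-treesUpTo : ∀ w f {b} → length w ≤ b →
    pushforward h linear f (wordTree A r w)
      ≈ sumOver (treesUpTo (suc b)) (λ t → hits (map t) w ⊗ f t)
  pushforward-treesUpTo w f {b} w≤b = ≈-trans
    (sumOver-↭ (∼bag⇒↭ (unique∧set⇒bag unique (Unique.filter⁺ hit? (treesUpTo-unique (suc b))) same)) f)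
    (sumOver-filter hit? f (treesUpTo (suc b)))
    where
    open Preimage (preimage h linear (wordTree A r w))

    hit? : Decidable (λ t → map t ≡ wordTree A r w)
    hit? t = map t ≟ᵗ wordTree A r w

    bounded : ∀ {t} → map t ≡ wordTree A r w → height t ≤ suc b
    bounded {t} ht≡ = ℕ.≤-trans (height-map h linear t)
      (ℕ.≤-trans (ℕ.≤-reflexive (cong height ht≡)) (ℕ.≤-trans (wordTree-height A r w) (s≤s w≤b)))

    same : ∀ {t} → (t ∈ elements) ⇔ (t ∈ filter hit? (treesUpTo (suc b)))
    same {t} = mk⇔
      (λ t∈ → let ht≡ = Equivalence.to (member t) t∈ in
              ∈-filter⁺ hit? (∈-treesUpTo _ t (bounded ht≡)) ht≡)
      (λ t∈ → Equivalence.from (member t)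
                (proj₂ (∈-filter⁻ hit? {xs = treesUpTo (suc b)} t∈)))

  module _ (ℬ : WFTA Λ) where

    open WFTA ℬ

    stateSeries : Fin states → Series
    stateSeries q w = pushforward h linear (λ t → stateBehavior t q) (wordTree A r w)

    private
      lookup-stateBehaviors : ∀ {k} (ts : Vec (Tree Λ) k) i →
                              lookup (stateBehaviors ts) i ≡ stateBehavior (lookup ts i)
      lookup-stateBehaviors (t ∷ ts) zero    = refl
      lookup-stateBehaviors (t ∷ ts) (suc i) = lookup-stateBehaviors ts i

      preimageHits : Tree Λ → Series
      preimageHits t = hits (map t)

      weights : ∀ {k} → Vec (Fin states) k → Vec (Tree Λ → Carrier) k
      weights = Vec.map (λ p t → stateBehavior t p)

      match-node : ∀ g ts w →
        hits (map (node g ts)) w ≈ eval (lookup (Vec.map preimageHits ts)) (image g) w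
      match-node g ts w = begin
        hits (map (node g ts)) w
          ≡⟨ cong (λ t → hits t w) (map-node g ts) ⟩
        hits (image g [ Vec.map map ts ]) w
          ≈⟨ eval-match (Vec.map map ts) (image g) w ⟨
        eval (λ i → hits (lookup (Vec.map map ts) i)) (image g) w
          ≈⟨ eval-cong {n = length w} (λ i v _ → reflexive (cong (λ η → η v)
               (≡.trans (cong hits (Vec.lookup-map i map ts))
                        (≡.sym (Vec.lookup-map i preimageHits ts)))))
               (image g) w ℕ.≤-refl ⟩
        eval (lookup (Vec.map preimageHits ts)) (image g) w ∎

      weights-product : ∀ {k} (ps : Vec (Fin states) k) ts →
        product (λ i → lookup (stateBehaviors ts) i (lookup ps i))
          ≡ product (λ i → lookup (weights ps) i (lookup ts i))
      weights-product ps ts = ∏P.sum-cong-≗ λ i → ≡.trans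
        (cong (λ f → f (lookup ps i)) (lookup-stateBehaviors ts i))
        (cong (λ f → f (lookup ts i)) (≡.sym (Vec.lookup-map i (λ p t → stateBehavior t p) ps)))

    stateSeries-recursion : ∀ q w → stateSeries q w ≈
      sumOver (allSymbols Λ) (λ g → sumOver (tuples (allFin states) (rank Λ g)) (λ ps →
        transition g ps q ⊗ eval (λ i → stateSeries (lookup ps i)) (image g) w))
    stateSeries-recursion q w = begin
      stateSeries q w
        ≈⟨ pushforward-treesUpTo w _ (ℕ.n≤1+n (length w)) ⟩
      sumOver (treesUpTo (suc b)) (λ t → hits (map t) w ⊗ stateBehavior t q)
        ≈⟨ sumOver-concatMap (allSymbols Λ) (λ g → List.map (node g) (tuples trees (rank Λ g))) _ ⟩
      sumOver (allSymbols Λ) (λ g → sumOver (List.map (node g) (tuples trees (rank Λ g)))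
        (λ t → hits (map t) w ⊗ stateBehavior t q))
        ≈⟨ sumOver-cong (allSymbols Λ) (λ g → ≈-trans
             (reflexive (sumOver-map (tuples trees (rank Λ g)) (node g) _)) (atSymbol g)) ⟩
      sumOver (allSymbols Λ) (λ g → sumOver (tuples (allFin states) (rank Λ g)) (λ ps →
        transition g ps q ⊗ eval (λ i → stateSeries (lookup ps i)) (image g) w)) ∎
      where
      -- One level more than the preimages for `w` require. The children are then enumerated up to
      -- height `suc (length w)`, which is enough for every word of length at most that of `w`, so
      -- no strict decrease has to be tracked through `eval`.
      b = suc (length w)

      trees : List (Tree Λ)
      trees = treesUpTo b

      atTuple : ∀ g ps →
        sumOver (tuples trees (rank Λ g)) (λ ts → hits (map (node g ts)) w ⊗
          (transition g ps q ⊗ product (λ i → lookup (stateBehaviors ts) i (lookup ps i))))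
        ≈ transition g ps q ⊗ eval (λ i → stateSeries (lookup ps i)) (image g) w
      atTuple g ps = begin
        sumOver (tuples trees k) (λ ts → hits (map (node g ts)) w ⊗
          (transition g ps q ⊗ product (λ i → lookup (stateBehaviors ts) i (lookup ps i))))
          ≈⟨ sumOver-cong (tuples trees k) (λ ts → ≈-trans
               (*-cong (match-node g ts w) (*-congˡ (reflexive (weights-product ps ts))))
               (≈-trans (*P.x∙yz≈y∙xz _ _ _) (*-congˡ (*-comm _ _)))) ⟩
        sumOver (tuples trees k) (λ ts → transition g ps q ⊗
          (product (λ i → lookup (weights ps) i (lookup ts i)) ⊗ F (Vec.map preimageHits ts)))
          ≈⟨ sumOver-⊗ˡ (tuples trees k) _ _ ⟨
        transition g ps q ⊗ sumOver (tuples trees k) (λ ts →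
          product (λ i → lookup (weights ps) i (lookup ts i)) ⊗ F (Vec.map preimageHits ts))
          -- For fixed states `ps` the weight of a tuple of subtrees is a product with one factor
          -- per slot, and `F` is linear in each slot because its variable occurs exactly once in
          -- `image g`.
          ≈⟨ *-congˡ (multilinear-sum trees F
               (λ θs i κ θ → eval-linear trees θs i κ θ (image g) w (proj₂ (linear g) i))
               (weights ps) preimageHits) ⟩
        transition g ps q ⊗
          F (Vec.map (λ κ → combination trees κ preimageHits) (weights ps))
          ≈⟨ *-congˡ (eval-cong childSeries (image g) w ℕ.≤-refl) ⟩
        transition g ps q ⊗ eval (λ i → stateSeries (lookup ps i)) (image g) w ∎
        where
        k = rank Λ g

        F : Vec Series k → Carrier
        F θs = eval (lookup θs) (image g) w

        childSeries : ∀ i v → length v ≤ length w →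
          lookup (Vec.map (λ κ → combination trees κ preimageHits) (weights ps)) i v
            ≈ stateSeries (lookup ps i) v
        childSeries i v v≤w = begin
          lookup (Vec.map (λ κ → combination trees κ preimageHits) (weights ps)) i v
            ≡⟨ cong (λ η → η v) (≡.trans
                 (Vec.lookup-map i (λ κ → combination trees κ preimageHits) (weights ps))
                 (cong (λ κ → combination trees κ preimageHits)
                   (Vec.lookup-map i (λ p t → stateBehavior t p) ps))) ⟩
          sumOver trees (λ t → stateBehavior t (lookup ps i) ⊗ hits (map t) v)
            ≈⟨ sumOver-cong trees (λ t → *-comm _ _) ⟩
          sumOver trees (λ t → hits (map t) v ⊗ stateBehavior t (lookup ps i))
            ≈⟨ pushforward-treesUpTo v _ v≤w ⟨
          stateSeries (lookup ps i) v ∎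

      atSymbol : ∀ g →
        sumOver (tuples trees (rank Λ g))
          (λ ts → hits (map (node g ts)) w ⊗ stateBehavior (node g ts) q)
        ≈ sumOver (tuples (allFin states) (rank Λ g)) (λ ps →
            transition g ps q ⊗ eval (λ i → stateSeries (lookup ps i)) (image g) w)
      atSymbol g = begin
        sumOver (tuples trees (rank Λ g))
          (λ ts → hits (map (node g ts)) w ⊗ stateBehavior (node g ts) q)
          ≈⟨ sumOver-cong (tuples trees (rank Λ g)) (λ ts →
               sumOver-⊗ˡ (tuples (allFin states) (rank Λ g)) _ _) ⟩
        sumOver (tuples trees (rank Λ g)) (λ ts →
          sumOver (tuples (allFin states) (rank Λ g)) (λ ps → hits (map (node g ts)) w ⊗
            (transition g ps q ⊗ product (λ i → lookup (stateBehaviors ts) i (lookup ps i)))))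
          -- The states are summed outside, so that the inner sum over subtrees has fixed states and
          -- factors slot by slot.
          ≈⟨ sumOver-swap (tuples trees (rank Λ g)) (tuples (allFin states) (rank Λ g)) _ ⟩
        sumOver (tuples (allFin states) (rank Λ g)) (λ ps →
          sumOver (tuples trees (rank Λ g)) (λ ts → hits (map (node g ts)) w ⊗
            (transition g ps q ⊗ product (λ i → lookup (stateBehaviors ts) i (lookup ps i)))))
          ≈⟨ sumOver-cong (tuples (allFin states) (rank Λ g)) (atTuple g) ⟩
        sumOver (tuples (allFin states) (rank Λ g)) (λ ps →
          transition g ps q ⊗ eval (λ i → stateSeries (lookup ps i)) (image g) w) ∎

-- Unambiguous tree automata and the subset construction

-- Precisely what makes the sums over child states and over final states have at most one nonzero
-- term. It covers both a determinised automaton and an automaton in which the symbol itself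
-- dictates the child states.
record Unambiguous {Γ : RankedAlphabet} (ℬ : TreeAutomaton Γ) : Set where
  open TreeAutomaton ℬ
  field
    children-unique : ∀ {g} {ts : Vec (Tree Γ) (rank Γ g)} {ps ps′ : Vec _ (rank Γ g)} {q} → Pointwise Run ts ps → T (transition g ps q) →
                      Pointwise Run ts ps′ → T (transition g ps′ q) → ps ≡ ps′
    final-unique    : ∀ {t q q′} → Run t q → T (final q) → Run t q′ → T (final q′) → q ≡ q′

module _ {n : ℕ} where

  -- The states of an automaton form some `Fin`, so a subset is coded by its characteristic
  -- function, read as the binary digits of a number below `2 ^ n`.
  member : Fin (2 ℕ.^ n) → Pred (Fin n) 0ℓ
  member P q = Fin.finToFun P q ≡ suc zero

  member? : ∀ P → Decidable (member P)
  member? P q = Fin.finToFun P q Fin.≟ suc zero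

  private
    bit : ∀ {p} {P : Set p} → Dec P → Fin 2
    bit d = if does d then suc zero else zero

    bit-⇔ : ∀ {p} {P : Set p} (d : Dec P) → (bit d ≡ suc zero) ⇔ P
    bit-⇔ (yes p) = mk⇔ (λ _ → p) (λ _ → refl)
    bit-⇔ (no ¬p) = mk⇔ (λ ()) (λ p → contradiction p ¬p)

    bit-cong : ∀ {p q} {P : Set p} {Q : Set q} (d : Dec P) (e : Dec Q) → P ⇔ Q → bit d ≡ bit e
    bit-cong d e P⇔Q = cong (if_then suc zero else zero) (does-⇔ P⇔Q d e)

  funToFin-cong : ∀ {k l} {f g : Fin k → Fin l} → (∀ i → f i ≡ g i) →
                  Fin.funToFin f ≡ Fin.funToFin g
  funToFin-cong {zero}  f≗g = refl
  funToFin-cong {suc k} f≗g = cong₂ Fin.combine (f≗g zero) (funToFin-cong (f≗g ∘ suc))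

  module _ {p} {P : Pred (Fin n) p} (P? : Decidable P) where

    subset : Fin (2 ℕ.^ n)
    subset = Fin.funToFin (λ q → bit (P? q))

    member-subset : ∀ q → member subset q ⇔ P q
    member-subset q = mk⇔
      (λ q∈ → to (≡.trans (≡.sym (Fin.finToFun-funToFin _ q)) q∈))
      (λ Pq → ≡.trans (Fin.finToFun-funToFin _ q) (from Pq))
      where open Equivalence (bit-⇔ (P? q))

  -- Codes are extensional: subsets with the same members are the same state. This is why the state
  -- reached at a tree is unique.
  subset-cong : ∀ {p q} {P : Pred (Fin n) p} {Q : Pred (Fin n) q}
                (P? : Decidable P) (Q? : Decidable Q) → (∀ x → P x ⇔ Q x) → subset P? ≡ subset Q?
  subset-cong P? Q? P⇔Q = funToFin-cong (λ x → bit-cong (P? x) (Q? x) (P⇔Q x))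

module Determinisation {Γ : RankedAlphabet} (ℬ : TreeAutomaton Γ) where

  open TreeAutomaton ℬ

  reach : Tree Γ → Fin (2 ℕ.^ states)
  reach t = subset (run? t)

  private
    Step : ∀ g → Vec (Fin (2 ℕ.^ states)) (rank Γ g) → Pred (Fin states) 0ℓ
    Step g Ps q = ∃[ ps ] Pointwise member Ps ps × T (transition g ps q)

    step? : ∀ g Ps → Decidable (Step g Ps)
    step? g Ps q = map′
      (λ any → let ps , _ , x = find any in ps , x)
      (λ (ps , x) → lose (∈-tuples⁺ ∈-allFin ps) x)
      (Any.any? (λ ps → Pointwise.decidable member? Ps ps ×-dec T? (transition g ps q))
                (tuples (allFin states) (rank Γ g)))

    accepting? : ∀ P → Dec (∃[ q ] member P q × T (final q))
    accepting? P = Fin.any? (λ q → member? P q ×-dec T? (final q))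

  determinised : TreeAutomaton Γ
  determinised = record
    { states     = 2 ℕ.^ states
    ; transition = λ g Ps P → ⌊ P Fin.≟ subset (step? g Ps) ⌋
    ; final      = λ P → ⌊ accepting? P ⌋
    }

  open TreeAutomaton determinised using ()
    renaming (Run to Run′; run to run′; final to final′; Accepts to Accepts′)

  private
    Reached : ∀ {k} → Vec (Tree Γ) k → Vec (Fin (2 ℕ.^ states)) k → Set
    Reached = Pointwise (λ t P → P ≡ reach t)

    member⇒run : ∀ {k} {ts : Vec _ k} {Ps} {ps : Vec _ k} → Reached ts Ps → Pointwise member Ps ps →
                 Pointwise Run ts ps
    member⇒run []            []       = []
    member⇒run (refl ∷ ts≈) (m ∷ ms) = Equivalence.to (member-subset (run? _) _) m ∷ member⇒run ts≈ ms

    run⇒member : ∀ {k} {ts : Vec _ k} {Ps} {ps : Vec _ k} → Reached ts Ps → Pointwise Run ts ps →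
                 Pointwise member Ps ps
    run⇒member []            []       = []
    run⇒member (refl ∷ ts≈) (r ∷ rs) = Equivalence.from (member-subset (run? _) _) r ∷ run⇒member ts≈ rs

    step-reach : ∀ {g ts Ps} → Reached ts Ps → subset (step? g Ps) ≡ reach (node g ts)
    step-reach {g} {ts} {Ps} ts≈ = subset-cong (step? g Ps) (run? (node g ts)) λ q → mk⇔
      (λ (ps , ms , δ) → run (member⇒run ts≈ ms) δ)
      (λ { (run rs δ) → _ , run⇒member ts≈ rs , δ })

    Reached-unique : ∀ {k} {ts : Vec _ k} {Ps Ps′} → Reached ts Ps → Reached ts Ps′ → Ps ≡ Ps′
    Reached-unique []          []            = refl
    Reached-unique (refl ∷ r) (refl ∷ r′) = cong (_ ∷_) (Reached-unique r r′)

  mutual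
    -- The transition forces `P` to be the step from the children's subsets, and these are the
    -- reached ones by induction. With `reach-run`, every tree has exactly one state.
    run-reach : ∀ {t P} → Run′ t P → P ≡ reach t
    run-reach (run′ rs δ) = ≡.trans (toWitness δ) (step-reach (runs-reach rs))

    runs-reach : ∀ {k} {ts : Vec _ k} {Ps} → Pointwise Run′ ts Ps → Reached ts Ps
    runs-reach []       = []
    runs-reach (r ∷ rs) = run-reach r ∷ runs-reach rs

  mutual
    reach-run : ∀ t → Run′ t (reach t)
    reach-run (node g ts) =
      run′ (reach-runs ts) (fromWitness (≡.sym (step-reach (runs-reach (reach-runs ts)))))

    reach-runs : ∀ {k} (ts : Vec _ k) → Pointwise Run′ ts (Vec.map reach ts)
    reach-runs []       = []
    reach-runs (t ∷ ts) = reach-run t ∷ reach-runs ts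

  determinised-unambiguous : Unambiguous determinised
  determinised-unambiguous = record
    { children-unique = λ rs _ rs′ _ → Reached-unique (runs-reach rs) (runs-reach rs′)
    ; final-unique    = λ r _ r′ _ → ≡.trans (run-reach r) (≡.sym (run-reach r′))
    }

  determinised-accepts : ∀ t → Accepts t ⇔ Accepts′ t
  determinised-accepts t = mk⇔
    (λ (q , r , f) → reach t , reach-run t ,
      fromWitness (q , Equivalence.from (member-subset (run? t) q) r , f))
    (λ (P , r , f) → let q , m , f′ = toWitness {a? = accepting? P} f in
      q , Equivalence.to (member-subset (run? t) q) (subst (λ P → member P q) (run-reach r) m) , f′)

regular⇒unambiguous : ∀ {Γ} {L : Pred (Tree Γ) 0ℓ} → Regular L →
  Σ[ ℬ ∈ TreeAutomaton Γ ] Unambiguous ℬ × (∀ t → L t ⇔ TreeAutomaton.Accepts ℬ t)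
regular⇒unambiguous (ℬ , L⇔ℬ) =
  determinised , determinised-unambiguous , λ t → ⇔.trans (L⇔ℬ t) (determinised-accepts t)
  where open Determinisation ℬ

-- One-state weights restricted to a regular language

module RunWeights {c ℓ} (S : CommutativeSemiring c ℓ) {Λ : RankedAlphabet} where

  open Weighted S
  open Sums S
  open import Relation.Binary.Reasoning.Setoid setoid

  module _ (κ : Symbol Λ → Carrier) where

    mutual
      weight : Tree Λ → Carrier
      weight (node g ts) = κ g ⊗ weights ts

      weights : ∀ {k} → Vec (Tree Λ) k → Carrier
      weights []       = 1#
      weights (t ∷ ts) = weight t ⊗ weights ts

  module _ (δ : (g : Symbol Λ) → Vec (Fin 1) (rank Λ g) → Fin 1 → Carrier)
           (ρ : Fin 1 → Carrier) where

    oneState : WFTA Λ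
    oneState = record { states = 1 ; transition = δ ; root = ρ }

    nodeWeight : Symbol Λ → Carrier
    nodeWeight g = δ g (replicate _ zero) zero

    open WFTA oneState

    private
      sumOver-tuples : ∀ k (f : Vec (Fin 1) k → Carrier) →
                       sumOver (tuples (allFin 1) k) f ≈ f (replicate k zero)
      sumOver-tuples zero    f = +-identityʳ _
      sumOver-tuples (suc k) f = ≈-trans
        (sumOver-cartesianProductWith _∷_ (allFin 1) (tuples (allFin 1) k) f)
        (≈-trans (+-identityʳ _) (sumOver-tuples k (f ∘ (zero ∷_))))

    mutual
      -- There is only one tuple over `Fin 1`, so every sum collapses and one factor per node
      -- remains.
      stateBehavior-oneState : ∀ t → stateBehavior t zero ≈ weight nodeWeight t
      stateBehavior-oneState (node g ts) =
        ≈-trans (sumOver-tuples (rank Λ g) _) (*-congˡ (stateBehaviors-oneState ts))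

      stateBehaviors-oneState : ∀ {k} (ts : Vec (Tree Λ) k) →
        product (λ i → lookup (stateBehaviors ts) i (lookup (replicate k zero) i))
          ≈ weights nodeWeight ts
      stateBehaviors-oneState []       = ≈-refl
      stateBehaviors-oneState (t ∷ ts) =
        *-cong (stateBehavior-oneState t) (stateBehaviors-oneState ts)

    behavior-oneState : ∀ t → behavior t ≈ ρ zero ⊗ weight nodeWeight t
    behavior-oneState t = ≈-trans (+-identityʳ _) (*-congˡ (stateBehavior-oneState t))

  module _ (κ : Symbol Λ → Carrier) (ℬ : TreeAutomaton Λ) (unambiguous : Unambiguous ℬ) where

    open TreeAutomaton ℬ
    open Unambiguous unambiguous

    -- The root weight of the one-state automaton is left out here and enters later through
    -- `acceptance`.
    weightedRuns : WFTA Λ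
    weightedRuns = record
      { states     = states
      ; transition = λ g ps q → κ g ⊗ ⟦ T? (transition g ps q) ⟧
      ; root       = λ q → ⟦ T? (final q) ⟧
      }

    open WFTA weightedRuns using (stateBehavior; stateBehaviors)

    private
      runs : ∀ {k} (ts : Vec _ k) (ps : Vec _ k) → Dec (Pointwise Run ts ps)
      runs = Pointwise.decidable run?

    mutual
      -- All runs on a tree carry the same weight, the product of `κ` over its nodes. The sum would
      -- be that weight times the number of runs, and `children-unique` leaves at most one tuple at
      -- each node.
      stateBehavior-weightedRuns : ∀ t q → stateBehavior t q ≈ weight κ t ⊗ ⟦ run? t q ⟧
      stateBehavior-weightedRuns (node g ts) q = begin
        sumOver (tuples (allFin states) (rank Λ g)) (λ ps → κ g ⊗ ⟦ T? (transition g ps q) ⟧ ⊗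
          product (λ i → lookup (stateBehaviors ts) i (lookup ps i)))
          ≈⟨ sumOver-cong (tuples (allFin states) (rank Λ g)) (λ ps → begin
               κ g ⊗ ⟦ T? (transition g ps q) ⟧ ⊗
               product (λ i → lookup (stateBehaviors ts) i (lookup ps i))
                 ≈⟨ *-congˡ (stateBehaviors-weightedRuns ts ps) ⟩
               κ g ⊗ ⟦ T? (transition g ps q) ⟧ ⊗ (weights κ ts ⊗ ⟦ runs ts ps ⟧)
                 ≈⟨ *P.interchange _ _ _ _ ⟩
               weight κ (node g ts) ⊗ (⟦ T? (transition g ps q) ⟧ ⊗ ⟦ runs ts ps ⟧)
                 ≈⟨ *-comm _ _ ⟩
               ⟦ T? (transition g ps q) ⟧ ⊗ ⟦ runs ts ps ⟧ ⊗ weight κ (node g ts)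
                 ≈⟨ *-congʳ (⟦⟧-× (T? (transition g ps q)) (runs ts ps)) ⟨
               ⟦ last? ps ⟧ ⊗ weight κ (node g ts) ∎) ⟩
        sumOver (tuples (allFin states) (rank Λ g)) (λ ps → ⟦ last? ps ⟧ ⊗ weight κ (node g ts))
          ≈⟨ total (run? (node g ts) q) ⟩
        weight κ (node g ts) ⊗ ⟦ run? (node g ts) q ⟧ ∎
        where
        last? : Decidable (λ ps → T (transition g ps q) × Pointwise Run ts ps)
        last? ps = T? (transition g ps q) ×-dec runs ts ps

        total : (d : Dec (Run (node g ts) q)) →
          sumOver (tuples (allFin states) (rank Λ g)) (λ ps → ⟦ last? ps ⟧ ⊗ weight κ (node g ts))
            ≈ weight κ (node g ts) ⊗ ⟦ d ⟧
        total (yes (run {ps = ps} rs δ)) = ≈-trans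
          (sumOver-single last? (λ _ → weight κ (node g ts))
            (tuples-unique (Unique.allFin⁺ states) (rank Λ g)) (∈-tuples⁺ ∈-allFin ps)
            (δ , rs) (λ (δ′ , rs′) → children-unique rs′ δ′ rs δ))
          (≈-sym (*-identityʳ _))
        total (no ¬r) = ≈-trans
          (sumOver-none last? (λ _ → weight κ (node g ts)) (tuples (allFin states) (rank Λ g))
            (λ _ (δ , rs) → ¬r (run rs δ)))
          (≈-sym (zeroʳ _))

      stateBehaviors-weightedRuns : ∀ {k} (ts : Vec _ k) (ps : Vec _ k) →
        product (λ i → lookup (stateBehaviors ts) i (lookup ps i)) ≈ weights κ ts ⊗ ⟦ runs ts ps ⟧
      stateBehaviors-weightedRuns []       []       = ≈-sym (*-identityˡ _)
      stateBehaviors-weightedRuns (t ∷ ts) (p ∷ ps) = begin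
        stateBehavior t p ⊗ product (λ i → lookup (stateBehaviors ts) i (lookup ps i))
          ≈⟨ *-cong (stateBehavior-weightedRuns t p) (stateBehaviors-weightedRuns ts ps) ⟩
        (weight κ t ⊗ ⟦ run? t p ⟧) ⊗ (weights κ ts ⊗ ⟦ runs ts ps ⟧)
          ≈⟨ *P.interchange _ _ _ _ ⟩
        weights κ (t ∷ ts) ⊗ (⟦ run? t p ⟧ ⊗ ⟦ runs ts ps ⟧)
          ≈⟨ *-congˡ (⟦⟧-× (run? t p) (runs ts ps)) ⟨
        weights κ (t ∷ ts) ⊗ ⟦ runs (t ∷ ts) (p ∷ ps) ⟧ ∎

    -- By `final-unique` at most one state is both final and reached, so the sum over states counts
    -- a tree of `L` exactly once and every other tree not at all.
    weight-⊙-𝟙 : ∀ {L : Pred (Tree Λ) 0ℓ} (L? : Decidable L) → (∀ t → L t ⇔ Accepts t) → ∀ t →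
      weight κ t ⊗ 𝟙 L? t ≈ sumOver (allFin states) (λ q → ⟦ T? (final q) ⟧ ⊗ stateBehavior t q)
    weight-⊙-𝟙 L? L⇔ t = ≈-sym (≈-trans
      (sumOver-cong (allFin states) (λ q → begin
        ⟦ T? (final q) ⟧ ⊗ stateBehavior t q
          ≈⟨ *-congˡ (≈-trans (stateBehavior-weightedRuns t q) (*-comm _ _)) ⟩
        ⟦ T? (final q) ⟧ ⊗ (⟦ run? t q ⟧ ⊗ weight κ t)
          ≈⟨ *-assoc _ _ _ ⟨
        ⟦ T? (final q) ⟧ ⊗ ⟦ run? t q ⟧ ⊗ weight κ t
          ≈⟨ *-congʳ (⟦⟧-× (T? (final q)) (run? t q)) ⟨
        ⟦ accept? q ⟧ ⊗ weight κ t ∎))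
      (total (L? t)))
      where
      accept? : Decidable (λ q → T (final q) × Run t q)
      accept? q = T? (final q) ×-dec run? t q

      total : (d : Dec _) →
        sumOver (allFin states) (λ q → ⟦ accept? q ⟧ ⊗ weight κ t) ≈ weight κ t ⊗ ⟦ d ⟧
      total (yes Lt) with Equivalence.to (L⇔ t) Lt
      ... | q , r , f = ≈-trans
        (sumOver-single accept? (λ _ → weight κ t) (Unique.allFin⁺ states) (∈-allFin q) (f , r)
          (λ (f′ , r′) → final-unique r′ f′ r f))
        (≈-sym (*-identityʳ _))
      total (no ¬Lt) = ≈-trans
        (sumOver-none accept? (λ _ → weight κ t) (allFin states)
          (λ {q} _ (f , r) → ¬Lt (Equivalence.from (L⇔ t) (q , r , f))))
        (≈-sym (zeroʳ _))

-- Subterms, and guarded systems of term equations as WAFA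

module _ {Γ : RankedAlphabet} {n : ℕ} where

  mutual
    subterms : Term Γ n → List (Term Γ n)
    subterms (var i)     = var i ∷ []
    subterms (node g ts) = node g ts ∷ subterms* ts

    subterms* : ∀ {m} → Vec (Term Γ n) m → List (Term Γ n)
    subterms* []       = []
    subterms* (t ∷ ts) = subterms t ++ subterms* ts

  ∈-subterms : ∀ t → t ∈ subterms t
  ∈-subterms (var i)     = here refl
  ∈-subterms (node g ts) = here refl

  ∈-subterms* : ∀ {m t} (ts : Vec (Term Γ n) m) → t ∈ Vec.toList ts → t ∈ subterms* ts
  ∈-subterms* (t ∷ ts) (here refl) = ∈-++⁺ˡ (∈-subterms t)
  ∈-subterms* (t ∷ ts) (there t∈)  = ∈-++⁺ʳ (subterms t) (∈-subterms* ts t∈)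

  mutual
    subterms-closed : ∀ {g us x} t → node g us ∈ subterms t → x ∈ Vec.toList us → x ∈ subterms t
    subterms-closed (node g ts) (here refl) x∈us = there (∈-subterms* ts x∈us)
    subterms-closed (node g ts) (there u∈)  x∈us = there (subterms*-closed ts u∈ x∈us)
    subterms-closed (var i)     (here ())   x∈us

    subterms*-closed : ∀ {m g us x} (ts : Vec (Term Γ n) m) → node g us ∈ subterms* ts →
                       x ∈ Vec.toList us → x ∈ subterms* ts
    subterms*-closed (t ∷ ts) u∈ x∈us with ∈-++⁻ (subterms t) u∈
    ... | inj₁ u∈t  = ∈-++⁺ˡ (subterms-closed t u∈t x∈us)
    ... | inj₂ u∈ts = ∈-++⁺ʳ (subterms t) (subterms*-closed ts u∈ts x∈us)

-- A system of equations F q = Σ c · u⟨F⟩ whose right-hand sides start with a symbol determines a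
-- WAFA: its states are the subterms of the right-hand sides, since reading a letter replaces a
-- term by the product of its arguments.
module TermSystem {c ℓ} (S : CommutativeSemiring c ℓ) (A : Alphabet) (r : ℕ) {m : ℕ}
                  (rhs : Fin m → List (Weighted.Carrier S × Term (Ranked# A r) m))
                  (guarded : ∀ q {κ u} → (κ , u) ∈ rhs q → 1 ≤ symbolCount u) where

  open Weighted S
  open Sums S
  open Alphabet A using (_≟_)
  open Matching S A r
  open DecMembership (_≟ᵗ_ {Γ} {m}) using (_∈?_)
  open import Relation.Binary.Reasoning.Setoid setoid

  -- A polynomial whose indeterminates are terms: each summand is a coefficient with a product of
  -- terms.
  Summands : Set c
  Summands = List (Carrier × List (Term Γ m))

  -- A derivative by the letter `a`. The empty sum for # is the true value 0, since # matches no
  -- nonempty word. For a variable it is a placeholder, kept away by guardedness.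
  unfold : Alphabet.Symbol A → Term Γ m → Summands
  unfold a (var _)            = []
  unfold a (node nothing _)   = []
  unfold a (node (just b) us) = (⟦ b ≟ a ⟧ , Vec.toList us) ∷ []

  -- A variable is replaced by its right-hand side before a letter is read. One replacement
  -- suffices, because guarded right-hand sides start with a symbol.
  expand : Alphabet.Symbol A → Term Γ m → Summands
  expand a (var q)     =
    concatMap (λ (κ , u) → List.map (λ (κ′ , l) → κ ⊗ κ′ , l) (unfold a u)) (rhs q)
  expand a (node g us) = unfold a (node g us)

  private
    subtermsOfSummand : Carrier × Term Γ m → List (Term Γ m)
    subtermsOfSummand (κ , u) = subterms u

    subtermsOfRhs : Fin m → List (Term Γ m)
    subtermsOfRhs q = concatMap subtermsOfSummand (rhs q)

  -- The variables are listed separately because the initial polynomial refers to each of them,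
  -- whether or not it occurs in a right-hand side.
  stateTerms : List (Term Γ m)
  stateTerms = List.map var (allFin m) ++ concatMap subtermsOfRhs (allFin m)

  var∈ : ∀ q → var q ∈ stateTerms
  var∈ q = ∈-++⁺ˡ (∈-map⁺ var (∈-allFin q))

  subterms∈ : ∀ {q κ u t} → (κ , u) ∈ rhs q → t ∈ subterms u → t ∈ stateTerms
  subterms∈ {q} u∈ t∈u = ∈-++⁺ʳ (List.map var (allFin m))
    (∈-concatMap⁺ subtermsOfRhs (lose (∈-allFin q)
      (∈-concatMap⁺ subtermsOfSummand (lose u∈ t∈u))))

  children∈ : ∀ {g us x} → node g us ∈ stateTerms → x ∈ Vec.toList us → x ∈ stateTerms
  children∈ u∈ x∈us with ∈-++⁻ (List.map var (allFin m)) u∈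
  ... | inj₁ u∈vars with ∈-map⁻ var u∈vars
  ...   | _ , _ , ()
  children∈ u∈ x∈us | inj₂ u∈rhs
    with q , _ , u∈q ← find (∈-concatMap⁻ subtermsOfRhs {xs = allFin m} u∈rhs)
    with (κ , t) , t∈ , u∈t ← find (∈-concatMap⁻ subtermsOfSummand {xs = rhs q} u∈q)
    = subterms∈ t∈ (subterms-closed t u∈t x∈us)

  unfold-closed : ∀ {a u κ l x} → u ∈ stateTerms → (κ , l) ∈ unfold a u → x ∈ l → x ∈ stateTerms
  unfold-closed {u = node (just b) us} u∈ (here refl) x∈us = children∈ u∈ x∈us

  expand-closed : ∀ {a u κ l x} → u ∈ stateTerms → (κ , l) ∈ expand a u → x ∈ l → x ∈ stateTerms
  expand-closed {u = node _ _} u∈ l∈ x∈l = unfold-closed u∈ l∈ x∈l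
  expand-closed {a} {u = var q} u∈ l∈ x∈l
    with (κ , t) , t∈ , l∈t ← find (∈-concatMap⁻
           (λ (κ , u) → List.map (λ (κ′ , l) → κ ⊗ κ′ , l) (unfold a u)) {xs = rhs q} l∈)
    with _ , l∈unfold , refl ← ∈-map⁻ (λ (κ′ , l) → κ ⊗ κ′ , l) l∈t
    = unfold-closed (subterms∈ t∈ (∈-subterms t)) l∈unfold x∈l

  private
    N : ℕ
    N = length stateTerms

    term : Fin N → Term Γ m
    term = List.lookup stateTerms

    -- Terms outside of `stateTerms` do not occur; they are sent to the default i.
    code : Fin N → Term Γ m → Fin N
    code i t with t ∈? stateTerms
    ... | yes t∈ = Any.index t∈
    ... | no  _  = i

    term-code : ∀ i {t} → t ∈ stateTerms → term (code i t) ≡ t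
    term-code i {t} t∈ with t ∈? stateTerms
    ... | yes t∈′ = ≡.sym (Any.lookup-index t∈′)
    ... | no  t∉  = contradiction t∈ t∉

  module _ (F : Fin m → Series)
           (F-solves : ∀ q w → F q w ≈ sumOver (rhs q) (λ (κ , u) → κ ⊗ eval F u w)) where

    private
      value : Summands → Series
      value p v = sumOver p (λ (κ , l) → κ ⊗ prodOver l (λ u → eval F u v))

      evalAll-prodOver : ∀ {k} (us : Vec (Term Γ m) k) v →
                         evalAll F us v ≡ prodOver (Vec.toList us) (λ u → eval F u v)
      evalAll-prodOver []       v = refl
      evalAll-prodOver (u ∷ us) v = cong (eval F u v ⊗_) (evalAll-prodOver us v)

      eval-unfold : ∀ u a v → 1 ≤ symbolCount u → eval F u (a ∷ v) ≈ value (unfold a u) v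
      eval-unfold (node nothing _)   a v _ = ≈-refl
      eval-unfold (node (just b) us) a v _ =
        ≈-trans (*-congˡ (reflexive (evalAll-prodOver us v))) (≈-sym (+-identityʳ _))

      eval-expand : ∀ u a v → eval F u (a ∷ v) ≈ value (expand a u) v
      eval-expand (node g us) a v = eval-unfold (node g us) a v (s≤s z≤n)
      eval-expand (var q)     a v = begin
        F q (a ∷ v)
          ≈⟨ F-solves q (a ∷ v) ⟩
        sumOver (rhs q) (λ (κ , u) → κ ⊗ eval F u (a ∷ v))
          ≈⟨ sumOver-cong-∈ (rhs q) (λ {(κ , u)} u∈ → begin
               κ ⊗ eval F u (a ∷ v)
                 ≈⟨ *-congˡ (eval-unfold u a v (guarded q u∈)) ⟩
               κ ⊗ value (unfold a u) v
                 ≈⟨ sumOver-⊗ˡ (unfold a u) κ _ ⟩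
               sumOver (unfold a u) (λ (κ′ , l) → κ ⊗ (κ′ ⊗ prodOver l (λ u → eval F u v)))
                 ≈⟨ sumOver-cong (unfold a u) (λ _ → ≈-sym (*-assoc _ _ _)) ⟩
               sumOver (unfold a u) (λ (κ′ , l) → κ ⊗ κ′ ⊗ prodOver l (λ u → eval F u v))
                 ≡⟨ sumOver-map (unfold a u) (λ (κ′ , l) → κ ⊗ κ′ , l) _ ⟨
               value (List.map (λ (κ′ , l) → κ ⊗ κ′ , l) (unfold a u)) v ∎) ⟩
        sumOver (rhs q) (λ (κ , u) → value (List.map (λ (κ′ , l) → κ ⊗ κ′ , l) (unfold a u)) v)
          ≈⟨ sumOver-concatMap (rhs q)
               (λ (κ , u) → List.map (λ (κ′ , l) → κ ⊗ κ′ , l) (unfold a u)) _ ⟨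
        value (expand a (var q)) v ∎

    -- The solution `F` enters only through the terminal weights, its values at the empty word. The
    -- transitions come from the equations alone.
    systemWAFA : (Fin m → Carrier) → WAFA A
    systemWAFA ι = record
      { states     = N
      ; transition = λ i a →
          List.map (λ (κ , l) → κ , exponents (List.map (code i) l)) (expand a (term i))
      ; initial    = List.map (λ q → ι q , exponents (Any.index (var∈ q) ∷ [])) (allFin m)
      ; terminal   = λ i → eval F (term i) []
      }

    module _ (ι : Fin m → Carrier) where

      open WAFA (systemWAFA ι)

      stateBehavior-system : ∀ w i → stateBehavior w i ≈ eval F (term i) w
      stateBehavior-system []      i = ≈-refl
      stateBehavior-system (a ∷ v) i = begin
        transition i a ⟨ stateBehavior v ⟩
          ≡⟨ sumOver-map (expand a (term i)) (λ (κ , l) → κ , exponents (List.map (code i) l)) _ ⟩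
        sumOver (expand a (term i)) (λ (κ , l) →
          κ ⊗ monomial (stateBehavior v) (exponents (List.map (code i) l)))
          ≈⟨ sumOver-cong-∈ (expand a (term i)) (λ {(κ , l)} l∈ → *-congˡ (begin
               monomial (stateBehavior v) (exponents (List.map (code i) l))
                 ≈⟨ monomial-exponents (stateBehavior v) (List.map (code i) l) ⟩
               prodOver (List.map (code i) l) (stateBehavior v)
                 ≡⟨ prodOver-map (stateBehavior v) (code i) l ⟩
               prodOver l (λ u → stateBehavior v (code i u))
                 -- Every factor is again one of the `stateTerms` by `expand-closed`, so `code`
                 -- never falls back on its default.
                 ≈⟨ prodOver-cong l (λ {u} u∈l → ≈-trans (stateBehavior-system v (code i u))
                      (reflexive (cong (λ u → eval F u v)
                        (term-code i (expand-closed (∈-lookup i) l∈ u∈l))))) ⟩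
               prodOver l (λ u → eval F u v) ∎)) ⟩
        value (expand a (term i)) v
          ≈⟨ eval-expand (term i) a v ⟨
        eval F (term i) (a ∷ v) ∎

      behavior-system : ∀ w → behavior w ≈ sumOver (allFin m) (λ q → ι q ⊗ F q w)
      behavior-system w = ≈-trans
        (reflexive (sumOver-map (allFin m) (λ q → ι q , exponents (Any.index (var∈ q) ∷ [])) _))
        (sumOver-cong (allFin m) (λ q → *-congˡ (begin
          monomial (stateBehavior w) (exponents (Any.index (var∈ q) ∷ []))
            ≈⟨ monomial-exponents (stateBehavior w) (Any.index (var∈ q) ∷ []) ⟩
          stateBehavior w (Any.index (var∈ q)) ⊗ 1#
            ≈⟨ *-identityʳ _ ⟩
          stateBehavior w (Any.index (var∈ q))
            ≈⟨ stateBehavior-system w (Any.index (var∈ q)) ⟩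
          eval F (term (Any.index (var∈ q))) w
            ≡⟨ cong (λ u → eval F u w) (Any.lookup-index (var∈ q)) ⟨
          F q w ∎)))

-- From a weighted regular language to a WAFA

module Nivat {c ℓ} (S : CommutativeSemiring c ℓ) (A : Alphabet) (r : ℕ)
             {Λ : RankedAlphabet} (h : TreeHom Λ (Ranked# A r)) (linear : Linear h)
             (δ : (g : Symbol Λ) → Vec (Fin 1) (rank Λ g) → Fin 1 → Weighted.Carrier S)
             (ρ : Fin 1 → Weighted.Carrier S)
             (ℬ : TreeAutomaton Λ) (unambiguous : Unambiguous ℬ) where

  open Weighted S
  open Sums S
  open Matching S A r
  open StateSeries S A r h linear
  open RunWeights S {Λ}
  open TreeHom h using (image)
  open TreeAutomaton ℬ using (states; final; transition; Accepts)
  open import Relation.Binary.Reasoning.Setoid setoid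

  κ : Symbol Λ → Carrier
  κ = nodeWeight δ ρ

  runSeries : Fin states → Series
  runSeries = stateSeries (weightedRuns κ ℬ unambiguous)

  runSeries-recursion : ∀ q w → runSeries q w ≈
    sumOver (allSymbols Λ) (λ g → sumOver (tuples (allFin states) (rank Λ g)) (λ ps →
      κ g ⊗ ⟦ T? (transition g ps q) ⟧ ⊗ eval (λ i → runSeries (lookup ps i)) (image g) w))
  runSeries-recursion = stateSeries-recursion (weightedRuns κ ℬ unambiguous)

  acceptance : Fin states → Carrier
  acceptance q = ρ zero ⊗ ⟦ T? (final q) ⟧

  -- Replaces the product with `𝟙` by a linear combination of state behaviors, after which the sum
  -- over preimages can be taken state by state. It holds for any decision procedure for `L`, which
  -- need not come from `ℬ`.
  pushforward-runSeries :
    ∀ {L : Pred (Tree Λ) 0ℓ} (L? : Decidable L) → (∀ t → L t ⇔ Accepts t) → ∀ w →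
    pushforward h linear (WFTA.behavior (oneState δ ρ) ⊙ 𝟙 L?) (wordTree A r w)
      ≈ sumOver (allFin states) (λ q → acceptance q ⊗ runSeries q w)
  pushforward-runSeries L? L⇔ w = begin
    sumOver elements (λ t → WFTA.behavior (oneState δ ρ) t ⊗ 𝟙 L? t)
      ≈⟨ sumOver-cong elements (λ t → begin
           WFTA.behavior (oneState δ ρ) t ⊗ 𝟙 L? t
             ≈⟨ *-congʳ (behavior-oneState δ ρ t) ⟩
           ρ zero ⊗ weight κ t ⊗ 𝟙 L? t
             ≈⟨ *-assoc _ _ _ ⟩
           ρ zero ⊗ (weight κ t ⊗ 𝟙 L? t)
             ≈⟨ *-congˡ (weight-⊙-𝟙 κ ℬ unambiguous L? L⇔ t) ⟩
           ρ zero ⊗ sumOver (allFin states) (λ q → ⟦ T? (final q) ⟧ ⊗ stateBehavior t q)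
             ≈⟨ sumOver-⊗ˡ (allFin states) _ _ ⟩
           sumOver (allFin states) (λ q → ρ zero ⊗ (⟦ T? (final q) ⟧ ⊗ stateBehavior t q))
             ≈⟨ sumOver-cong (allFin states) (λ q → ≈-sym (*-assoc _ _ _)) ⟩
           sumOver (allFin states) (λ q → acceptance q ⊗ stateBehavior t q) ∎) ⟩
    sumOver elements (λ t → sumOver (allFin states) (λ q → acceptance q ⊗ stateBehavior t q))
      ≈⟨ sumOver-swap elements (allFin states) _ ⟩
    sumOver (allFin states) (λ q → sumOver elements (λ t → acceptance q ⊗ stateBehavior t q))
      ≈⟨ sumOver-cong (allFin states) (λ q → ≈-sym (sumOver-⊗ˡ elements _ _)) ⟩
    sumOver (allFin states) (λ q → acceptance q ⊗ runSeries q w) ∎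
    where
    open Preimage (preimage h linear (wordTree A r w))
    open WFTA (weightedRuns κ ℬ unambiguous) using (stateBehavior)

  private
    -- Filling the variables of `image g` with states makes the run series the unknowns of one
    -- finite system. A state may fill several variables, so an unknown can occur repeatedly
    -- although `h` is linear.
    instances : Fin states → (g : Symbol Λ) → List (Carrier × Term Γ states)
    instances q g = List.map
      (λ ps → κ g ⊗ ⟦ T? (transition g ps q) ⟧ , image g [ Vec.map var ps ])
      (tuples (allFin states) (rank Λ g))

    rhs : Fin states → List (Carrier × Term Γ states)
    rhs q = concatMap (instances q) (allSymbols Λ)

    symbolCount-[] : ∀ {k l} (u : Term Γ k) (us : Vec (Term Γ l) k) → 1 ≤ symbolCount u →
                     1 ≤ symbolCount (u [ us ])
    symbolCount-[] (node g ts) us _ = s≤s z≤n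

    guarded : ∀ q {κ′ u} → (κ′ , u) ∈ rhs q → 1 ≤ symbolCount u
    guarded q u∈
      with g , _ , u∈g ← find (∈-concatMap⁻ (instances q) {xs = allSymbols Λ} u∈)
      with ps , _ , refl ← ∈-map⁻ (λ ps → κ g ⊗ ⟦ T? (transition g ps q) ⟧ ,
                                          image g [ Vec.map var ps ]) u∈g
      = symbolCount-[] (image g) (Vec.map var ps) (proj₁ (linear g))

    runSeries-solves : ∀ q w →
      runSeries q w ≈ sumOver (rhs q) (λ (κ′ , u) → κ′ ⊗ eval runSeries u w)
    runSeries-solves q w = begin
      runSeries q w
        ≈⟨ runSeries-recursion q w ⟩
      sumOver (allSymbols Λ) (λ g → sumOver (tuples (allFin states) (rank Λ g)) (λ ps →
        κ g ⊗ ⟦ T? (transition g ps q) ⟧ ⊗ eval (λ i → runSeries (lookup ps i)) (image g) w))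
        ≈⟨ sumOver-cong (allSymbols Λ) (λ g → ≈-trans
             (sumOver-cong (tuples (allFin states) (rank Λ g)) (λ ps →
               *-congˡ (≈-sym (instance-eval g ps))))
             (reflexive (≡.sym (sumOver-map (tuples (allFin states) (rank Λ g)) _ _)))) ⟩
      sumOver (allSymbols Λ) (λ g → sumOver (instances q g) (λ (κ′ , u) → κ′ ⊗ eval runSeries u w))
        ≈⟨ sumOver-concatMap (allSymbols Λ) (instances q) _ ⟨
      sumOver (rhs q) (λ (κ′ , u) → κ′ ⊗ eval runSeries u w) ∎
      where
      instance-eval : ∀ g ps → eval runSeries (image g [ Vec.map var ps ]) w
                                 ≈ eval (λ i → runSeries (lookup ps i)) (image g) w
      instance-eval g ps = ≈-trans
        (reflexive (eval-[] runSeries (Vec.map var ps) (image g) w))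
        (eval-cong {n = length w} (λ i v _ → reflexive
          (cong (λ u → eval runSeries u v) (Vec.lookup-map i var ps))) (image g) w ℕ.≤-refl)

  module System = TermSystem S A r rhs guarded

  runSeries-WAFA : WAFA A
  runSeries-WAFA = System.systemWAFA runSeries runSeries-solves acceptance

  behavior-runSeries-WAFA : ∀ w →
    WAFA.behavior runSeries-WAFA w ≈ sumOver (allFin states) (λ q → acceptance q ⊗ runSeries q w)
  behavior-runSeries-WAFA = System.behavior-system runSeries runSeries-solves acceptance

-- Trees over a transition table

module _ {Λ Γ : RankedAlphabet} (image : (g : Symbol Λ) → Term Γ (rank Λ g)) where

  private
    mutual
      extend : Tree Λ → Tree Γ
      extend (node g ts) = image g [ extends ts ]

      extends : ∀ {k} → Vec (Tree Λ) k → Vec (Tree Γ) k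
      extends []       = []
      extends (t ∷ ts) = extend t ∷ extends ts

    extends-map : ∀ {k} (ts : Vec (Tree Λ) k) → extends ts ≡ Vec.map extend ts
    extends-map []       = refl
    extends-map (t ∷ ts) = cong (extend t ∷_) (extends-map ts)

  homomorphism : TreeHom Λ Γ
  homomorphism = record
    { map      = extend
    ; image    = image
    ; map-node = λ g ts → cong (image g [_]) (extends-map ts)
    }

module _ {Γ : RankedAlphabet} {n : ℕ} where

  occurrences-absent : ∀ {k} (f : Fin k → Fin n) i → (∀ j → i ≢ f j) →
                       occurrences* {Γ} i (Vec.tabulate (var ∘ f)) ≡ 0
  occurrences-absent {zero}  f i i∉ = refl
  occurrences-absent {suc k} f i i∉ with i Fin.≟ f zero
  ... | yes i≡ = contradiction i≡ (i∉ zero)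
  ... | no  _  = occurrences-absent (f ∘ suc) i (i∉ ∘ suc)

  -- Stated for an injective `f` because the tail of the vector is tabulated by `f ∘ suc`. The case
  -- needed is the identity.
  occurrences-tabulate : ∀ {k} (f : Fin k → Fin n) → (∀ {i j} → f i ≡ f j → i ≡ j) → ∀ i →
                         occurrences* {Γ} (f i) (Vec.tabulate (var ∘ f)) ≡ 1
  occurrences-tabulate f inj zero with f zero Fin.≟ f zero
  ... | yes _ = cong suc (occurrences-absent (f ∘ suc) (f zero) (λ j eq → Fin.0≢1+n (inj eq)))
  ... | no ¬p = contradiction refl ¬p
  occurrences-tabulate f inj (suc i) with f (suc i) Fin.≟ f zero
  ... | yes p = contradiction (≡.sym (inj p)) Fin.0≢1+n
  ... | no  _ = occurrences-tabulate (f ∘ suc) (Fin.suc-injective ∘ inj) i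

record Entry {c} (C : Set c) (Γ : RankedAlphabet) (m : ℕ) : Set c where
  constructor entry
  field
    label       : Symbol Γ
    source      : Fin m
    coefficient : C
    targets     : Vec (Fin m) (rank Γ label)

-- The entries of a transition table become the symbols of Λ: a run is a tree over Λ whose entries
-- fit together, and forgetting all but the labels is a linear homomorphism.
module Table {c ℓ} (S : CommutativeSemiring c ℓ) (A : Alphabet) (r : ℕ) {m : ℕ}
             (e₀ : Entry (Weighted.Carrier S) (Ranked# A r) m)
             (es : List (Entry (Weighted.Carrier S) (Ranked# A r) m)) (initial : Fin m) where

  open Weighted S
  open Sums S
  open Matching S A r
  open Entry
  open import Relation.Binary.Reasoning.Setoid setoid

  -- The first entry is given separately because an alphabet has to be nonempty.
  entries : List (Entry Carrier Γ m)
  entries = e₀ ∷ es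

  entryOf : Fin (length entries) → Entry Carrier Γ m
  entryOf = List.lookup entries

  entryAlphabet : RankedAlphabet
  entryAlphabet = record
    { alphabet = record { Symbol = Fin (length entries) ; size-1 = length es ; finite = ↔-id _ }
    ; rank     = λ i → rank Γ (label (entryOf i))
    }

  flatTerm : ∀ g → Term Γ (rank Γ g)
  flatTerm g = node g (Vec.tabulate var)

  labels : TreeHom entryAlphabet Γ
  labels = homomorphism (λ i → flatTerm (label (entryOf i)))

  labels-linear : Linear labels
  labels-linear i = s≤s z≤n , occurrences-tabulate id id

  private
    fits? : ∀ i ps q → Dec (source (entryOf i) ≡ q × targets (entryOf i) ≡ ps)
    fits? i ps q = source (entryOf i) Fin.≟ q ×-dec Vec.≡-dec Fin._≟_ (targets (entryOf i)) ps

  -- Trees are accepted at the root, where a run of the WAFA begins. The only final state is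
  -- therefore `initial`.
  runs : TreeAutomaton entryAlphabet
  runs = record
    { states     = m
    ; transition = λ i ps q → ⌊ fits? i ps q ⌋
    ; final      = λ q → ⌊ q Fin.≟ initial ⌋
    }

  runs-unambiguous : Unambiguous runs
  runs-unambiguous = record
    { children-unique = λ {i} {ts} {ps} {ps′} {q} _ δ _ δ′ → ≡.trans
        (≡.sym (proj₂ (toWitness {a? = fits? i ps q} δ)))
        (proj₂ (toWitness {a? = fits? i ps′ q} δ′))
    ; final-unique    = λ {t} {q} {q′} _ f _ f′ → ≡.trans
        (toWitness {a? = q Fin.≟ initial} f) (≡.sym (toWitness {a? = q′ Fin.≟ initial} f′))
    }

  open Nivat S A r labels labels-linear (λ i _ _ → coefficient (entryOf i)) (λ _ → 1#)
                   runs runs-unambiguous public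

  contribution : Fin m → Word A → Entry Carrier Γ m → Carrier
  contribution q w e = ⟦ source e Fin.≟ q ⟧ ⊗
    (coefficient e ⊗ eval (λ i → runSeries (lookup (targets e) i)) (flatTerm (label e)) w)

  -- A symbol fits a single tuple of child states, its own `targets`, so the sum over tuples
  -- collapses to one term per entry.
  runSeries-entries : ∀ q w → runSeries q w ≈ sumOver entries (contribution q w)
  runSeries-entries q w = begin
    runSeries q w
      ≈⟨ runSeries-recursion q w ⟩
    sumOver (allSymbols entryAlphabet) (λ i → sumOver (tuples (allFin m) (rank entryAlphabet i))
      (λ ps → coefficient (entryOf i) ⊗ ⟦ fit? i ps ⟧ ⊗ body i ps))
      ≈⟨ sumOver-cong (allSymbols entryAlphabet) (λ i → ≈-trans
           (sumOver-cong (tuples (allFin m) (rank entryAlphabet i)) (λ ps →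
             ≈-trans (*-assoc _ _ _) (*P.x∙yz≈y∙xz _ _ _)))
           (total i (source (entryOf i) Fin.≟ q))) ⟩
    sumOver (allSymbols entryAlphabet) (λ i → contribution q w (entryOf i))
      ≡⟨ sumOver-map (allSymbols entryAlphabet) entryOf (contribution q w) ⟨
    sumOver (List.map entryOf (allSymbols entryAlphabet)) (contribution q w)
      ≡⟨ cong (λ l → sumOver l (contribution q w)) entries-allSymbols ⟩
    sumOver entries (contribution q w) ∎
    where
    fit? : ∀ i ps → Dec (T ⌊ fits? i ps q ⌋)
    fit? i ps = T? ⌊ fits? i ps q ⌋

    body : ∀ i → Vec (Fin m) (rank entryAlphabet i) → Carrier
    body i ps = eval (λ j → runSeries (lookup ps j)) (flatTerm (label (entryOf i))) w

    entries-allSymbols : List.map entryOf (allSymbols entryAlphabet) ≡ entries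
    entries-allSymbols = ≡.trans (cong (List.map entryOf) (List.map-id (allFin (length entries))))
      (≡.trans (List.map-tabulate id entryOf) (List.tabulate-lookup entries))

    total : ∀ i (d : Dec (source (entryOf i) ≡ q)) →
      sumOver (tuples (allFin m) (rank entryAlphabet i))
        (λ ps → ⟦ fit? i ps ⟧ ⊗ (coefficient (entryOf i) ⊗ body i ps))
      ≈ ⟦ d ⟧ ⊗ (coefficient (entryOf i) ⊗ body i (targets (entryOf i)))
    total i (yes s≡q) = ≈-trans
      (sumOver-single (fit? i) (λ ps → coefficient (entryOf i) ⊗ body i ps)
        (tuples-unique (Unique.allFin⁺ m) (rank entryAlphabet i))
        (∈-tuples⁺ ∈-allFin (targets (entryOf i)))
        (fromWitness {a? = fits? i (targets (entryOf i)) q} (s≡q , refl))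
        (λ {ps} f → ≡.sym (proj₂ (toWitness {a? = fits? i ps q} f))))
      (≈-sym (*-identityˡ _))
    total i (no s≢q) = ≈-trans
      (sumOver-none (fit? i) (λ ps → coefficient (entryOf i) ⊗ body i ps)
        (tuples (allFin m) (rank entryAlphabet i))
        (λ {ps} _ f → s≢q (proj₁ (toWitness {a? = fits? i ps q} f))))
      (≈-sym (zeroˡ _))

-- Degrees and composition of polynomials

module _ {a} {X : Set a} (f : X → ℕ) where

  maximumOver : List X → ℕ
  maximumOver = foldr (λ x b → f x ⊔ b) 0

  ≤-maximumOver : ∀ {x xs} → x ∈ xs → f x ≤ maximumOver xs
  ≤-maximumOver {xs = x ∷ xs} (here refl) = ℕ.m≤m⊔n (f x) (maximumOver xs)
  ≤-maximumOver {xs = y ∷ xs} (there x∈)  = ℕ.m≤n⇒m≤o⊔n (f y) (≤-maximumOver x∈)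

module Monomials {c ℓ} (S : CommutativeSemiring c ℓ) {n : ℕ} where

  open Weighted S
  open Sums S
  open import Relation.Binary.Reasoning.Setoid setoid

  Monomials : Set c
  Monomials = List (Carrier × List (Fin n))

  infix 9 _⟪_⟫

  _⟪_⟫ : Monomials → (Fin n → Carrier) → Carrier
  p ⟪ f ⟫ = sumOver p (λ (κ , l) → κ ⊗ prodOver l f)

  factored : Polynomial n → Monomials
  factored = List.map (λ (κ , e) → κ , factors e)

  scale : Carrier → Monomials → Monomials
  scale κ = List.map (λ (κ′ , l) → κ ⊗ κ′ , l)

  _⊠_ : Monomials → Monomials → Monomials
  _⊠_ = cartesianProductWith (λ (κ , l) (κ′ , l′) → κ ⊗ κ′ , l ++ l′)

  substituteMonomial : List (Fin n) → (Fin n → Monomials) → Monomials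
  substituteMonomial l g = foldr (λ i p → g i ⊠ p) ((1# , []) ∷ []) l

  -- Composition of polynomials, multiplied out again into a list of monomials because each monomial
  -- is to become a symbol of its own.
  substitute : Monomials → (Fin n → Monomials) → Monomials
  substitute p g = concatMap (λ (κ , l) → scale κ (substituteMonomial l g)) p

  factored-⟨⟩ : ∀ p f → p ⟨ f ⟩ ≈ factored p ⟪ f ⟫
  factored-⟨⟩ p f = ≈-trans
    (sumOver-cong p (λ (κ , e) → *-congˡ (monomial-factors f e)))
    (reflexive (≡.sym (sumOver-map p (λ (κ , e) → κ , factors e) _)))

  scale-⟪⟫ : ∀ κ p f → scale κ p ⟪ f ⟫ ≈ κ ⊗ p ⟪ f ⟫
  scale-⟪⟫ κ p f = begin
    scale κ p ⟪ f ⟫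
      ≡⟨ sumOver-map p (λ (κ′ , l) → κ ⊗ κ′ , l) _ ⟩
    sumOver p (λ (κ′ , l) → κ ⊗ κ′ ⊗ prodOver l f)
      ≈⟨ sumOver-cong p (λ _ → *-assoc _ _ _) ⟩
    sumOver p (λ (κ′ , l) → κ ⊗ (κ′ ⊗ prodOver l f))
      ≈⟨ sumOver-⊗ˡ p κ _ ⟨
    κ ⊗ p ⟪ f ⟫ ∎

  ⊠-⟪⟫ : ∀ p q f → (p ⊠ q) ⟪ f ⟫ ≈ p ⟪ f ⟫ ⊗ q ⟪ f ⟫
  ⊠-⟪⟫ p q f = begin
    (p ⊠ q) ⟪ f ⟫
      ≈⟨ sumOver-cartesianProductWith (λ (κ , l) (κ′ , l′) → κ ⊗ κ′ , l ++ l′) p q _ ⟩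
    sumOver p (λ (κ , l) → sumOver q (λ (κ′ , l′) → κ ⊗ κ′ ⊗ prodOver (l ++ l′) f))
      ≈⟨ sumOver-cong p (λ (κ , l) → sumOver-cong q (λ (κ′ , l′) →
           ≈-trans (*-congˡ (prodOver-++ f l l′)) (*P.interchange _ _ _ _))) ⟩
    sumOver p (λ (κ , l) → sumOver q (λ (κ′ , l′) → (κ ⊗ prodOver l f) ⊗ (κ′ ⊗ prodOver l′ f)))
      ≈⟨ sumOver-product p q _ _ ⟨
    p ⟪ f ⟫ ⊗ q ⟪ f ⟫ ∎

  substituteMonomial-⟪⟫ : ∀ l g f →
    substituteMonomial l g ⟪ f ⟫ ≈ prodOver l (λ i → g i ⟪ f ⟫)
  substituteMonomial-⟪⟫ []      g f = ≈-trans (+-identityʳ _) (*-identityʳ 1#)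
  substituteMonomial-⟪⟫ (i ∷ l) g f =
    ≈-trans (⊠-⟪⟫ (g i) _ f) (*-congˡ (substituteMonomial-⟪⟫ l g f))

  substitute-⟪⟫ : ∀ p g f → substitute p g ⟪ f ⟫ ≈ p ⟪ (λ i → g i ⟪ f ⟫) ⟫
  substitute-⟪⟫ p g f = ≈-trans
    (sumOver-concatMap p (λ (κ , l) → scale κ (substituteMonomial l g)) _)
    (sumOver-cong p (λ (κ , l) →
      ≈-trans (scale-⟪⟫ κ (substituteMonomial l g) f) (*-congˡ (substituteMonomial-⟪⟫ l g f))))

  ⟪⟫-cong : ∀ p {f g} → (∀ i → f i ≈ g i) → p ⟪ f ⟫ ≈ p ⟪ g ⟫
  ⟪⟫-cong p f≈g = sumOver-cong p (λ (κ , l) → *-congˡ (prodOver-cong l (λ {i} _ → f≈g i)))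

-- From a WAFA to its transition table

-- Two states are added: one whose first step incorporates the initial polynomial, and one of
-- constant value 1, which fills monomials up to the common degree r.
module TransitionTable {c ℓ} (S : CommutativeSemiring c ℓ) {A : Alphabet} (M : Weighted.WAFA S A) where

  open Weighted S
  open Sums S
  open WAFA M renaming (states to n)
  open Monomials S {n}
  open Alphabet A using (_≟_; ∈-allSymbols) renaming (allSymbols to letters)
  open import Relation.Binary.Reasoning.Setoid setoid hiding (start)

  m : ℕ
  m = suc (suc n)

  pattern start = zero
  pattern one   = suc zero
  pattern old q = suc (suc q)

  value : Fin m → Word A → Carrier
  value start   w = behavior w
  value one     w = 1#
  value (old q) w = stateBehavior w q

  -- Successors are always old states. The start state composes the initial polynomial with the
  -- transitions, so one letter leads into the given automaton. The state `one` steps to the empty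
  -- monomial, whose targets are padding only.
  step : Fin m → Alphabet.Symbol A → Monomials
  step start   a = substitute (factored initial) (λ q → factored (transition q a))
  step one     a = (1# , []) ∷ []
  step (old q) a = factored (transition q a)

  value-step : ∀ q a v → value q (a ∷ v) ≈ step q a ⟪ stateBehavior v ⟫
  value-step start a v = begin
    initial ⟨ (λ q → transition q a ⟨ stateBehavior v ⟩) ⟩
      ≈⟨ factored-⟨⟩ initial _ ⟩
    factored initial ⟪ (λ q → transition q a ⟨ stateBehavior v ⟩) ⟫
      ≈⟨ ⟪⟫-cong (factored initial) (λ q → factored-⟨⟩ (transition q a) (stateBehavior v)) ⟩
    factored initial ⟪ (λ q → factored (transition q a) ⟪ stateBehavior v ⟫) ⟫
      ≈⟨ substitute-⟪⟫ (factored initial) (λ q → factored (transition q a)) (stateBehavior v) ⟨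
    step start a ⟪ stateBehavior v ⟫ ∎
  value-step one     a v = ≈-sym (≈-trans (+-identityʳ _) (*-identityʳ 1#))
  value-step (old q) a v = factored-⟨⟩ (transition q a) (stateBehavior v)

  private
    degree : Carrier × List (Fin n) → ℕ
    degree (κ , l) = length l

    degreeOfStep : Alphabet.Symbol A → Fin m → ℕ
    degreeOfStep a q = maximumOver degree (step q a)

    degreeOfLetter : Alphabet.Symbol A → ℕ
    degreeOfLetter a = maximumOver (degreeOfStep a) (allFin m)

  -- The successor guarantees rank at least 1 even if every polynomial is constant.
  r : ℕ
  r = suc (maximumOver degreeOfLetter letters)

  step-degree : ∀ q a {κ l} → (κ , l) ∈ step q a → length l ≤ r
  step-degree q a l∈ = ℕ.≤-trans (≤-maximumOver degree l∈)
    (ℕ.≤-trans (≤-maximumOver (degreeOfStep a) (∈-allFin q))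
      (ℕ.m≤n⇒m≤1+n (≤-maximumOver degreeOfLetter (∈-allSymbols a))))

  open Matching S A r

  -- A list longer than `k` would be truncated. `step-degree` rules this out at `r`.
  pad : ∀ k → List (Fin n) → Vec (Fin m) k
  pad zero    _       = []
  pad (suc k) []      = one ∷ pad k []
  pad (suc k) (q ∷ l) = old q ∷ pad k l

  pad-product : ∀ {k} l (f : Fin m → Carrier) → f one ≈ 1# → length l ≤ k →
                product (λ i → f (lookup (pad k l) i)) ≈ prodOver l (λ q → f (old q))
  pad-product {zero}  []      f f1≈1 _         = ≈-refl
  pad-product {suc k} []      f f1≈1 _         =
    ≈-trans (*-cong f1≈1 (pad-product {k} [] f f1≈1 z≤n)) (*-identityˡ _)
  pad-product {suc k} (q ∷ l) f f1≈1 (s≤s l≤k) = *-congˡ (pad-product l f f1≈1 l≤k)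

  evalAll-tabulate : ∀ {k l} (θ : Fin l → Series) (g : Fin k → Fin l) v →
                     evalAll θ (Vec.tabulate (var ∘ g)) v ≡ product (λ i → θ (g i) v)
  evalAll-tabulate {zero}  θ g v = refl
  evalAll-tabulate {suc k} θ g v = cong (θ (g zero) v ⊗_) (evalAll-tabulate θ (g ∘ suc) v)

  -- The symbols over # carry the values at the empty word: the terminal weight for an old state,
  -- the initial polynomial evaluated at the terminal weights for `start`, and 1 for `one`.
  leaf : Fin m → Entry Carrier Γ m
  leaf q = entry nothing q (value q []) []

  letterEntry : Alphabet.Symbol A → Fin m → Carrier × List (Fin n) → Entry Carrier Γ m
  letterEntry a q (κ , l) = entry (just a) q κ (pad r l)

  entriesAt : Alphabet.Symbol A → Fin m → List (Entry Carrier Γ m)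
  entriesAt a q = List.map (letterEntry a q) (step q a)

  entriesFor : Alphabet.Symbol A → List (Entry Carrier Γ m)
  entriesFor a = concatMap (entriesAt a) (allFin m)

  letterEntries : List (Entry Carrier Γ m)
  letterEntries = concatMap entriesFor letters

  -- Head and tail together compute to `List.map leaf (allFin m) ++
  -- letterEntries`, the form in which `runSeries-split` takes them.
  open Table S A r (leaf start) (List.map leaf (List.tabulate suc) ++ letterEntries) start public

  sumOver-letterEntries : ∀ f → sumOver letterEntries f ≈
    sumOver letters (λ b → sumOver (allFin m) (λ p → sumOver (step p b) (f ∘ letterEntry b p)))
  sumOver-letterEntries f = ≈-trans (sumOver-concatMap letters entriesFor f)
    (sumOver-cong letters (λ b → ≈-trans (sumOver-concatMap (allFin m) (entriesAt b) f)
      (sumOver-cong (allFin m) (λ p → reflexive (sumOver-map (step p b) (letterEntry b p) f)))))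

  runSeries-split : ∀ q w → runSeries q w ≈
    sumOver (allFin m) (contribution q w ∘ leaf) ⊕
    sumOver letters (λ b → sumOver (allFin m) (λ p →
      sumOver (step p b) (contribution q w ∘ letterEntry b p)))
  runSeries-split q w = begin
    runSeries q w
      ≈⟨ runSeries-entries q w ⟩
    sumOver (List.map leaf (allFin m) ++ letterEntries) (contribution q w)
      ≈⟨ sumOver-++ (List.map leaf (allFin m)) letterEntries _ ⟩
    sumOver (List.map leaf (allFin m)) (contribution q w) ⊕ sumOver letterEntries (contribution q w)
      ≈⟨ +-cong (reflexive (sumOver-map (allFin m) leaf _)) (sumOver-letterEntries _) ⟩
    sumOver (allFin m) (contribution q w ∘ leaf) ⊕
    sumOver letters (λ b → sumOver (allFin m) (λ p →
      sumOver (step p b) (contribution q w ∘ letterEntry b p))) ∎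

  -- At the empty word only the leaf of `q` contributes. At a nonempty word all leaves vanish, and
  -- the indicators select the letter read and the source `q`. What remains is the step of `q`
  -- evaluated at the suffix, to which the induction hypothesis applies.
  runSeries≈value : ∀ w q → runSeries q w ≈ value q w
  runSeries≈value [] q = begin
    runSeries q []
      ≈⟨ runSeries-split q [] ⟩
    sumOver (allFin m) (contribution q [] ∘ leaf) ⊕
    sumOver letters (λ b → sumOver (allFin m) (λ p →
      sumOver (step p b) (contribution q [] ∘ letterEntry b p)))
      ≈⟨ +-cong
           (sumOver-single (Fin._≟ q) (λ p → value p [] ⊗ 1#) (Unique.allFin⁺ m) (∈-allFin q) refl id)
           (sumOver-zero letters (λ _ → sumOver-zero (allFin m) (λ {p} _ → sumOver-zero (step p _)
             (λ _ → ≈-trans (*-congˡ (zeroʳ _)) (zeroʳ _))))) ⟩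
    value q [] ⊗ 1# ⊕ 0#
      ≈⟨ ≈-trans (+-identityʳ _) (*-identityʳ _) ⟩
    value q [] ∎
  runSeries≈value (a ∷ v) q = begin
    runSeries q (a ∷ v)
      ≈⟨ runSeries-split q (a ∷ v) ⟩
    sumOver (allFin m) (contribution q (a ∷ v) ∘ leaf) ⊕
    sumOver letters (λ b → sumOver (allFin m) (λ p →
      sumOver (step p b) (contribution q (a ∷ v) ∘ letterEntry b p)))
      ≈⟨ +-cong
           (sumOver-zero (allFin m) (λ _ → ≈-trans (*-congˡ (zeroʳ _)) (zeroʳ _)))
           (sumOver-cong letters (λ b → ≈-trans
             (sumOver-cong (allFin m) (λ p → atStep b p))
             (≈-sym (sumOver-⊗ˡ (allFin m) _ _)))) ⟩
    0# ⊕ sumOver letters (λ b → ⟦ b ≟ a ⟧ ⊗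
      sumOver (allFin m) (λ p → ⟦ p Fin.≟ q ⟧ ⊗ step p b ⟪ stateBehavior v ⟫))
      ≈⟨ +-identityˡ _ ⟩
    sumOver letters (λ b → ⟦ b ≟ a ⟧ ⊗
      sumOver (allFin m) (λ p → ⟦ p Fin.≟ q ⟧ ⊗ step p b ⟪ stateBehavior v ⟫))
      ≈⟨ sumOver-single (_≟ a) _ (allSymbols-unique A) (∈-allSymbols a) refl id ⟩
    sumOver (allFin m) (λ p → ⟦ p Fin.≟ q ⟧ ⊗ step p a ⟪ stateBehavior v ⟫)
      ≈⟨ sumOver-single (Fin._≟ q) _ (Unique.allFin⁺ m) (∈-allFin q) refl id ⟩
    step q a ⟪ stateBehavior v ⟫
      ≈⟨ value-step q a v ⟨
    value q (a ∷ v) ∎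
    where
    targetProduct : ∀ l → length l ≤ r →
      evalAll (λ i → runSeries (lookup (pad r l) i)) (Vec.tabulate var) v
        ≈ prodOver l (stateBehavior v)
    targetProduct l l≤r = begin
      evalAll (λ i → runSeries (lookup (pad r l) i)) (Vec.tabulate var) v
        ≡⟨ evalAll-tabulate (λ i → runSeries (lookup (pad r l) i)) id v ⟩
      product (λ i → runSeries (lookup (pad r l) i) v)
        ≈⟨ ∏P.sum-cong-≋ (λ i → runSeries≈value v (lookup (pad r l) i)) ⟩
      product (λ i → value (lookup (pad r l) i) v)
        ≈⟨ pad-product l (λ p → value p v) ≈-refl l≤r ⟩
      prodOver l (stateBehavior v) ∎

    atStep : ∀ b p → sumOver (step p b) (contribution q (a ∷ v) ∘ letterEntry b p)
                       ≈ ⟦ b ≟ a ⟧ ⊗ (⟦ p Fin.≟ q ⟧ ⊗ step p b ⟪ stateBehavior v ⟫)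
    atStep b p = begin
      sumOver (step p b) (contribution q (a ∷ v) ∘ letterEntry b p)
        ≈⟨ sumOver-cong-∈ (step p b) (λ {(κ , l)} l∈ → begin
             ⟦ p Fin.≟ q ⟧ ⊗ (κ ⊗ (⟦ b ≟ a ⟧ ⊗
               evalAll (λ i → runSeries (lookup (pad r l) i)) (Vec.tabulate var) v))
               ≈⟨ *-congˡ (*-congˡ (*-congˡ (targetProduct l (step-degree p b l∈)))) ⟩
             ⟦ p Fin.≟ q ⟧ ⊗ (κ ⊗ (⟦ b ≟ a ⟧ ⊗ prodOver l (stateBehavior v)))
               ≈⟨ *-congˡ (*P.x∙yz≈y∙xz _ _ _) ⟩
             ⟦ p Fin.≟ q ⟧ ⊗ (⟦ b ≟ a ⟧ ⊗ (κ ⊗ prodOver l (stateBehavior v)))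
               ≈⟨ *P.x∙yz≈y∙xz _ _ _ ⟩
             ⟦ b ≟ a ⟧ ⊗ (⟦ p Fin.≟ q ⟧ ⊗ (κ ⊗ prodOver l (stateBehavior v))) ∎) ⟩
      sumOver (step p b) (λ (κ , l) →
        ⟦ b ≟ a ⟧ ⊗ (⟦ p Fin.≟ q ⟧ ⊗ (κ ⊗ prodOver l (stateBehavior v))))
        ≈⟨ sumOver-⊗ˡ (step p b) _ _ ⟨
      ⟦ b ≟ a ⟧ ⊗ sumOver (step p b) (λ (κ , l) →
        ⟦ p Fin.≟ q ⟧ ⊗ (κ ⊗ prodOver l (stateBehavior v)))
        ≈⟨ *-congˡ (sumOver-⊗ˡ (step p b) _ _) ⟨
      ⟦ b ≟ a ⟧ ⊗ (⟦ p Fin.≟ q ⟧ ⊗ step p b ⟪ stateBehavior v ⟫) ∎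

  accepted-start : ∀ w → sumOver (allFin m) (λ q → acceptance q ⊗ runSeries q w) ≈ behavior w
  accepted-start w = begin
    sumOver (allFin m) (λ q → 1# ⊗ ⟦ accepts-start? q ⟧ ⊗ runSeries q w)
      ≈⟨ sumOver-cong (allFin m) (λ q → *-congʳ (*-identityˡ _)) ⟩
    sumOver (allFin m) (λ q → ⟦ accepts-start? q ⟧ ⊗ runSeries q w)
      ≈⟨ sumOver-single accepts-start? (λ q → runSeries q w) (Unique.allFin⁺ m) (∈-allFin start)
           _ (λ {q} f → toWitness {a? = q Fin.≟ start} f) ⟩
    runSeries start w
      ≈⟨ runSeries≈value w start ⟩
    behavior w ∎
    where
    accepts-start? : ∀ q → Dec (T ⌊ q Fin.≟ start ⌋)
    accepts-start? q = T? ⌊ q Fin.≟ start ⌋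

-- The two directions of the equivalence

theorem5p7 : ∀ {c ℓ} (S : CommutativeSemiring c ℓ) (A : Alphabet) →
    let open Weighted S in
    (s : Word A → Carrier) →
    (Σ[ M ∈ WAFA A ] Recognizes M s)
    ⇔
    (Σ[ r ∈ ℕ ] (1 ≤ r) ×
    (Σ[ Λ ∈ RankedAlphabet ]
    Σ[ h ∈ TreeHom Λ (Ranked# A r) ]
    Σ[ linear ∈ Linear h ]
    Σ[ L ∈ Pred (Tree Λ) 0ℓ ]
    Σ[ regular ∈ Regular L ]
    Σ[ 𝒜 ∈ WFTA Λ ] (WFTA.states 𝒜 ≡ 1) ×
    (∀ w → s w ≈ pushforward h linear (WFTA.behavior 𝒜 ⊙ 𝟙 (regular? regular)) (wordTree A r w))))
theorem5p7 S A s = mk⇔ to from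
  where
  open Weighted S
  open Sums S

  to : _
  to (M , M-recognizes) =
    r , s≤s z≤n , entryAlphabet , labels , labels-linear , TreeAutomaton.Accepts runs , regular ,
    RunWeights.oneState S (λ i _ _ → Entry.coefficient (entryOf i)) (λ _ → 1#) , refl , λ w →
    ≈-trans (≈-sym (M-recognizes w)) (≈-trans (≈-sym (accepted-start w))
      (≈-sym (pushforward-runSeries (regular? regular) (λ _ → ⇔.refl) w)))
    where
    open TransitionTable S M
    regular : Regular (TreeAutomaton.Accepts runs)
    regular = runs , λ _ → ⇔.refl

  from : _
  -- Matching the number of states with `refl` makes the state set literally `Fin 1`, the form in
  -- which `Nivat` takes `δ` and `ρ`.
  from (r , _ , Λ , h , linear , L , regular ,
        record { states = _ ; transition = δ ; root = ρ } , refl , s≈)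
    with ℬ , unambiguous , L⇔ ← regular⇒unambiguous regular
    -- The characteristic function is still decided by the given automaton, whereas the WAFA is
    -- built from the determinised `ℬ`. The equivalence `L⇔` reconciles the two.
    = runSeries-WAFA , λ w → ≈-trans (behavior-runSeries-WAFA w) (≈-sym (≈-trans (s≈ w)
        (pushforward-runSeries (regular? regular) L⇔ w)))
    where
    open Nivat S A r h linear δ ρ ℬ unambiguous
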